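{- Let $(\mathcal{N},\mathcal{I})$ be a matroid with $|\mathcal{N}|=n$ and rank $r$, let $f:2^{\mathcal{N}}\to\mathbb{R}$ be a non-monotone, non-negative submodular function, and let $\epsilon\in(0,1)$. Then the deterministic algorithm TwinGreedyFast (described in the context), run on $(\mathcal{N},\mathcal{I},f,\epsilon)$, returns a solution $S^*\in\mathcal{I}$ with $\frac14-\epsilon$ approximation ratio for the problem $\max\{f(S):S\in\mathcal{I}\}$, i.e. $f(S^*)\ge\left(\frac14-\epsilon\right)\max\{f(S):S\in\mathcal{I}\}$, and its time complexity is $\mathcal{O}\left(\frac{n}{\epsilon}\log\frac{r}{\epsilon}\right)$.
   Context: Submodular: $f(X)+f(Y)\ge f(X\cup Y)+f(X\cap Y)$ for all $X,Y\subseteq\mathcal{N}$. Non-negative: $f(X)\ge 0$ for all $X$. Non-monotone: there exist $X\subset Y\subseteq\mathcal{N}$ with $f(X)>f(Y)$. Marginal gain: $f(X\mid Y)=f(X\cup Y)-f(Y)$, and $f(x\mid Y)=f(\{x\}\mid Y)$; $f(e)=f(\{e\})$. $\mathcal{N}$ is finite, $\mathcal{I}\subseteq 2^{\mathcal{N}}$ is the family of independent sets, and $r=\max\{|S|:S\in\mathcal{I}\}\ge 1$. Algorithm TwinGreedyFast: let $\tau_{\max}=\max\{f(e):e\in\mathcal{N},\{e\}\in\mathcal{I}\}$ and $S_1=S_2=\emptyset$. For $\tau=\tau_{\max},\ \tau_{\max}/(1+\epsilon),\ \tau_{\max}/(1+\epsilon)^2,\dots$, as long as $\tau>\epsilon\tau_{\max}/[r(1+\epsilon)]$,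 do the following: go through the elements $e\in\mathcal{N}\setminus(S_1\cup S_2)$ one by one in arbitrary order; for each such $e$ set, for $j\in\{1,2\}$, $\Delta_j=f(e\mid S_j)$ if $S_j\cup\{e\}\in\mathcal{I}$ and $\Delta_j=-\infty$ otherwise (with the current $S_1,S_2$); let $i\in\arg\max_{j\in\{1,2\}}\Delta_j$ (ties broken arbitrarily); if $\Delta_i\ge\tau$, replace $S_i$ by $S_i\cup\{e\}$. At the end return $S^*\in\arg\max_{X\in\{S_1,S_2\}}f(X)$. Time complexity is measured with $f$ and membership in $\mathcal{I}$ given by oracles, each evaluation of $f$ and each test of membership in $\mathcal{I}$ counting as one step; $\mathcal{O}(\cdot)$ hides an absolute constant and is understood for $r/\epsilon$ bounded away from $1$ (say $r/\epsilon\ge 2$). -}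

module Defs where

open import Algebra.Bundles using (CommutativeRing)
open import Algebra.Core using (Op₁; Op₂)
open import Algebra.Structures using (IsCommutativeRing)
import Algebra.Properties.Group as GroupProperties
import Algebra.Properties.Ring as RingProperties
import Algebra.Properties.Semiring.Exp as Exp
import Algebra.Properties.Semiring.Mult as Mult
open import Data.Bool.Base using (Bool; true; false; if_then_else_)
open import Data.Empty using (⊥-elim)
open import Data.Fin.Base using (Fin)
open import Data.Fin.Subset
  using (Subset; ⊥; ⁅_⁆; _∈_; _∉_; _⊆_; _⊂_; _∪_; _∩_; ∣_∣)
open import Data.List.Base using (List; []; _∷_; allFin)
import Data.List.Membership.Propositional as List
open import Data.List.Relation.Unary.Unique.Propositional using (Unique)
open import Data.Nat.Base as ℕ using (ℕ; zero; suc)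
import Data.Nat.Properties as ℕ
open import Data.Product.Base using (_×_; _,_; ∃; ∃₂; ∃-syntax; proj₁)
open import Data.Sum.Base using (inj₁; inj₂)
open import Function.Bundles using (_⇔_)
open import Level using (0ℓ)
open import Relation.Binary.Bundles using (DecTotalOrder; StrictTotalOrder)
open import Relation.Binary.Core using (Rel)
open import Relation.Binary.Structures using (IsDecTotalOrder)
open import Relation.Binary.PropositionalEquality.Core as ≡ using (_≡_)
import Relation.Binary.Construct.Add.Infimum.NonStrict as AddInfimum
import Relation.Binary.Properties.DecTotalOrder as DecTotalOrderProperties
import Relation.Binary.Reasoning.PartialOrder as PartialOrderReasoning
open import Relation.Nullary.Construct.Add.Infimum using (_₋; ⊥₋; [_])
open import Relation.Nullary.Decidable.Core using (Dec; yes; no; does)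
open import Relation.Nullary.Negation.Core using (¬_)
open import Relation.Unary using (Pred; Decidable; Satisfiable)

-- The library has no real numbers, so ℝ is given axiomatically, as a
-- Dedekind-complete ordered field; classically it is unique up to
-- isomorphism.  The order is decidable because the algorithm compares
-- reals.  `archimedean` follows classically from `complete`, but not
-- constructively.

record Reals : Set₁ where
  infix  4 _≈_ _≤_
  infixl 6 _+_
  infixl 7 _*_
  infix  8 -_
  infix  9 _⁻¹
  field
    Carrier           : Set
    _≈_               : Rel Carrier 0ℓ
    _≤_               : Rel Carrier 0ℓ
    _+_ _*_           : Op₂ Carrier
    -_                : Op₁ Carrier
    0# 1#             : Carrier
    isCommutativeRing : IsCommutativeRing _≈_ _+_ _*_ -_ 0# 1#
    isDecTotalOrder   : IsDecTotalOrder _≈_ _≤_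
    0≉1               : ¬ (0# ≈ 1#)
    -- 0# ⁻¹ is unspecified.
    _⁻¹               : Op₁ Carrier
    ⁻¹-inverseʳ       : ∀ {x} → ¬ (x ≈ 0#) → x * x ⁻¹ ≈ 1#
    +-monoʳ-≤         : ∀ z {x y} → x ≤ y → z + x ≤ z + y
    *-nonNeg          : ∀ {x y} → 0# ≤ x → 0# ≤ y → 0# ≤ x * y

  commutativeRing : CommutativeRing 0ℓ 0ℓ
  commutativeRing = record { isCommutativeRing = isCommutativeRing }

  decTotalOrder : DecTotalOrder 0ℓ 0ℓ 0ℓ
  decTotalOrder = record { isDecTotalOrder = isDecTotalOrder }

  open CommutativeRing commutativeRing public
    using (ring; semiring; _-_)
  open DecTotalOrderProperties decTotalOrder public
    using (_<_; <-strictTotalOrder)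
  open StrictTotalOrder <-strictTotalOrder public
    using (_<?_)
  open DecTotalOrder decTotalOrder public
    using (_≤?_)
  open Exp semiring public using (_^_)
  open Mult semiring public using () renaming (_×_ to _·_)

  fromℕ : ℕ → Carrier
  fromℕ n = n · 1#

  infixl 7 _/_
  _/_ : Op₂ Carrier
  x / y = x * y ⁻¹

  UpperBound : Pred Carrier 0ℓ → Pred Carrier 0ℓ
  UpperBound P b = ∀ {x} → P x → x ≤ b

  IsSupremum : Pred Carrier 0ℓ → Pred Carrier 0ℓ
  IsSupremum P s = UpperBound P s × (∀ {b} → UpperBound P b → s ≤ b)

  IsMaximum : Pred Carrier 0ℓ → Pred Carrier 0ℓ
  IsMaximum P m = P m × UpperBound P m

  field
    archimedean : ∀ x → ∃[ n ] x ≤ fromℕ n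
    complete    : ∀ P → Satisfiable P → Satisfiable (UpperBound P) →
                  ∃ (IsSupremum P)

module Logarithm ⦃ ℝ : Reals ⦄ where
  open Reals ℝ
  open CommutativeRing commutativeRing hiding (Carrier; _≈_; _+_; _*_; -_; 0#; 1#; _-_; ring; semiring; isCommutativeRing; zero)
  open DecTotalOrder decTotalOrder
    using (poset; total; antisym)
    renaming (refl to ≤-refl; reflexive to ≤-reflexive; trans to ≤-trans;
              ≤-respˡ-≈ to ≤-respˡ; ≤-respʳ-≈ to ≤-respʳ)
  open Exp semiring using (^-homo-*; ^-assocʳ)
  open Mult semiring using (×-homo-+; ×1-homo-*)
  open RingProperties ring using (-‿distribˡ-*; x[y-z]≈xy-xz)
  open PartialOrderReasoning poset

  private
    2ℝ : Carrier
    2ℝ = fromℕ 2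

  +-mono-≤ : ∀ {x y u v} → x ≤ y → u ≤ v → x + u ≤ y + v
  +-mono-≤ {x} {y} {u} {v} x≤y u≤v = begin
    x + u  ≤⟨ +-monoʳ-≤ x u≤v ⟩
    x + v  ≈⟨ +-comm x v ⟩
    v + x  ≤⟨ +-monoʳ-≤ v x≤y ⟩
    v + y  ≈⟨ +-comm v y ⟩
    y + v  ∎

  x≤y⇒0≤y-x : ∀ {x y} → x ≤ y → 0# ≤ y - x
  x≤y⇒0≤y-x {x} {y} x≤y = begin
    0#     ≈⟨ -‿inverseʳ x ⟨
    x - x  ≤⟨ +-mono-≤ x≤y ≤-refl ⟩
    y - x  ∎

  0≤y-x⇒x≤y : ∀ {x y} → 0# ≤ y - x → x ≤ y
  0≤y-x⇒x≤y {x} {y} 0≤y-x = begin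
    x              ≈⟨ +-identityʳ x ⟨
    x + 0#         ≤⟨ +-monoʳ-≤ x 0≤y-x ⟩
    x + (y - x)    ≈⟨ +-congˡ (+-comm y (- x)) ⟩
    x + (- x + y)  ≈⟨ +-assoc x (- x) y ⟨
    x - x + y      ≈⟨ +-congʳ (-‿inverseʳ x) ⟩
    0# + y         ≈⟨ +-identityˡ y ⟩
    y              ∎

  *-monoˡ-≤ : ∀ {z x y} → 0# ≤ z → x ≤ y → z * x ≤ z * y
  *-monoˡ-≤ {z} {x} {y} 0≤z x≤y = 0≤y-x⇒x≤y
    (≤-respʳ (x[y-z]≈xy-xz z y x) (*-nonNeg 0≤z (x≤y⇒0≤y-x x≤y)))

  *-monoʳ-≤ : ∀ {z x y} → 0# ≤ z → x ≤ y → x * z ≤ y * z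
  *-monoʳ-≤ {z} {x} {y} 0≤z x≤y = begin
    x * z  ≈⟨ *-comm x z ⟩
    z * x  ≤⟨ *-monoˡ-≤ 0≤z x≤y ⟩
    z * y  ≈⟨ *-comm z y ⟩
    y * z  ∎

  0≤-1⇒0≤1 : 0# ≤ - 1# → 0# ≤ 1#
  0≤-1⇒0≤1 0≤-1 = begin
    0#           ≤⟨ *-nonNeg 0≤-1 0≤-1 ⟩
    - 1# * - 1#  ≈⟨ -‿distribˡ-* 1# (- 1#) ⟨
    - (1# * - 1#) ≈⟨ -‿cong (*-identityˡ (- 1#)) ⟩
    - - 1#       ≈⟨ GroupProperties.⁻¹-involutive +-group 1# ⟩
    1#           ∎

  0≤1 : 0# ≤ 1#
  0≤1 with total 0# 1#
  ... | inj₁ 0≤1 = 0≤1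
  ... | inj₂ 1≤0 =
    0≤-1⇒0≤1 (≤-respʳ (+-identityˡ (- 1#)) (x≤y⇒0≤y-x 1≤0))

  0≤fromℕ : ∀ n → 0# ≤ fromℕ n
  0≤fromℕ zero    = ≤-refl
  0≤fromℕ (suc n) = ≤-respˡ (+-identityˡ 0#) (+-mono-≤ 0≤1 (0≤fromℕ n))

  fromℕ-mono-≤ : ∀ {m n} → m ℕ.≤ n → fromℕ m ≤ fromℕ n
  fromℕ-mono-≤ {n = n} ℕ.z≤n = 0≤fromℕ n
  fromℕ-mono-≤ (ℕ.s≤s m≤n)   = +-monoʳ-≤ 1# (fromℕ-mono-≤ m≤n)

  fromℕ-suc≉0 : ∀ n → ¬ (fromℕ (suc n) ≈ 0#)
  fromℕ-suc≉0 n eq = 0≉1 (antisym 0≤1 (begin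
    1#             ≈⟨ +-identityʳ 1# ⟨
    1# + 0#        ≤⟨ +-monoʳ-≤ 1# (0≤fromℕ n) ⟩
    fromℕ (suc n)  ≈⟨ eq ⟩
    0#             ∎))

  0≤x⇒0≤x⁻¹ : ∀ {x} → ¬ (x ≈ 0#) → 0# ≤ x → 0# ≤ x ⁻¹
  0≤x⇒0≤x⁻¹ {x} x≉0 0≤x with total 0# (x ⁻¹)
  ... | inj₁ 0≤x⁻¹ = 0≤x⁻¹
  ... | inj₂ x⁻¹≤0 = ⊥-elim (0≉1 (antisym 0≤1 (begin
    1#         ≈⟨ ⁻¹-inverseʳ x≉0 ⟨
    x * x ⁻¹   ≤⟨ *-monoˡ-≤ 0≤x x⁻¹≤0 ⟩
    x * 0#     ≈⟨ zeroʳ x ⟩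
    0#         ∎)))

  ^-nonNeg : ∀ {x} → 0# ≤ x → ∀ n → 0# ≤ x ^ n
  ^-nonNeg 0≤x zero    = 0≤1
  ^-nonNeg 0≤x (suc n) = *-nonNeg 0≤x (^-nonNeg 0≤x n)

  ^-monoˡ-≤ : ∀ {x y} → 0# ≤ x → x ≤ y → ∀ n → x ^ n ≤ y ^ n
  ^-monoˡ-≤ 0≤x x≤y zero    = ≤-refl
  ^-monoˡ-≤ 0≤x x≤y (suc n) = ≤-trans
    (*-monoʳ-≤ (^-nonNeg 0≤x n) x≤y)
    (*-monoˡ-≤ (≤-trans 0≤x x≤y) (^-monoˡ-≤ 0≤x x≤y n))

  2*x≈x+x : ∀ x → 2ℝ * x ≈ x + x
  2*x≈x+x x = begin-equality
    (1# + (1# + 0#)) * x  ≈⟨ *-congʳ (+-congˡ (+-identityʳ 1#)) ⟩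
    (1# + 1#) * x         ≈⟨ distribʳ x 1# 1# ⟩
    1# * x + 1# * x       ≈⟨ +-cong (*-identityˡ x) (*-identityˡ x) ⟩
    x + x                 ∎

  1+n≤2^n : ∀ n → fromℕ (suc n) ≤ 2ℝ ^ n
  1+n≤2^n zero    = ≤-reflexive (+-identityʳ 1#)
  1+n≤2^n (suc n) = begin
    1# + fromℕ (suc n)    ≤⟨ +-mono-≤ 1≤2^n (1+n≤2^n n) ⟩
    2ℝ ^ n + 2ℝ ^ n       ≈⟨ 2*x≈x+x (2ℝ ^ n) ⟨
    2ℝ * 2ℝ ^ n           ∎
    where
    1≤2^n : 1# ≤ 2ℝ ^ n
    1≤2^n = begin
      1#             ≈⟨ +-identityʳ 1# ⟨
      1# + 0#        ≤⟨ +-monoʳ-≤ 1# (0≤fromℕ n) ⟩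
      fromℕ (suc n)  ≤⟨ 1+n≤2^n n ⟩
      2ℝ ^ n         ∎

  fromℕ≤2^ : ∀ n → fromℕ n ≤ 2ℝ ^ n
  fromℕ≤2^ n = ≤-trans (fromℕ-mono-≤ (ℕ.n≤1+n n)) (1+n≤2^n n)

  2^1+k≰1 : ∀ k → ¬ (2ℝ ^ suc k ≤ 1#)
  2^1+k≰1 k 2^≤1 = 0≉1 (antisym 0≤1 (begin
    1#                 ≈⟨ +-identityˡ 1# ⟨
    0# + 1#            ≈⟨ +-congʳ (-‿inverseˡ 1#) ⟨
    (- 1# + 1#) + 1#   ≈⟨ +-assoc (- 1#) 1# 1# ⟩
    - 1# + (1# + 1#)   ≈⟨ +-congˡ (+-congˡ (+-identityʳ 1#)) ⟨
    - 1# + 2ℝ          ≤⟨ +-monoʳ-≤ (- 1#) (fromℕ-mono-≤ {2} {suc (suc k)} (ℕ.s≤s (ℕ.s≤s ℕ.z≤n))) ⟩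
    - 1# + fromℕ (suc (suc k)) ≤⟨ +-monoʳ-≤ (- 1#) (1+n≤2^n (suc k)) ⟩
    - 1# + 2ℝ ^ suc k  ≤⟨ +-monoʳ-≤ (- 1#) 2^≤1 ⟩
    - 1# + 1#          ≈⟨ -‿inverseˡ 1# ⟩
    0#                 ∎))

  2^-reflects-≤ : ∀ m n → 2ℝ ^ m ≤ 2ℝ ^ n → m ℕ.≤ n
  2^-reflects-≤ zero    n       _   = ℕ.z≤n
  2^-reflects-≤ (suc m) zero    leq = ⊥-elim (2^1+k≰1 m leq)
  2^-reflects-≤ (suc m) (suc n) leq = ℕ.s≤s (2^-reflects-≤ m n (begin
    2ℝ ^ m               ≈⟨ cancel (2ℝ ^ m) ⟨
    2ℝ ⁻¹ * 2ℝ ^ suc m   ≤⟨ *-monoˡ-≤ (0≤x⇒0≤x⁻¹ (fromℕ-suc≉0 1) (0≤fromℕ 2)) leq ⟩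
    2ℝ ⁻¹ * 2ℝ ^ suc n   ≈⟨ cancel (2ℝ ^ n) ⟩
    2ℝ ^ n               ∎))
    where
    cancel : ∀ x → 2ℝ ⁻¹ * (2ℝ * x) ≈ x
    cancel x = begin-equality
      2ℝ ⁻¹ * (2ℝ * x)  ≈⟨ *-assoc _ _ _ ⟨
      2ℝ ⁻¹ * 2ℝ * x    ≈⟨ *-congʳ (trans (*-comm _ _) (⁻¹-inverseʳ (fromℕ-suc≉0 1))) ⟩
      1# * x            ≈⟨ *-identityˡ x ⟩
      x                 ∎

  -- The rationals (a − b)/q, q ≥ 1, with 2 ^ ((a − b)/q) ≤ x, the
  -- inequality being raised to the power q and multiplied by 2 ^ b.
  BelowLog₂ : Carrier → Pred Carrier 0ℓ
  BelowLog₂ x y = ∃[ a ] ∃[ b ] ∃[ q-1 ]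
    y ≈ (fromℕ a - fromℕ b) / fromℕ (suc q-1) ×
    fromℕ 2 ^ a ≤ fromℕ 2 ^ b * x ^ suc q-1

  belowLog₂-nonempty : ∀ x → 0# < x → Satisfiable (BelowLog₂ x)
  belowLog₂-nonempty x (0≤x , 0≉x) with archimedean (x ⁻¹)
  ... | b , x⁻¹≤b = _ , 0 , b , 0 , refl , (begin
    1#                ≈⟨ ⁻¹-inverseʳ (λ x≈0 → 0≉x (sym x≈0)) ⟨
    x * x ⁻¹          ≈⟨ *-comm x (x ⁻¹) ⟩
    x ⁻¹ * x          ≤⟨ *-monoʳ-≤ 0≤x (≤-trans x⁻¹≤b (fromℕ≤2^ b)) ⟩
    2ℝ ^ b * x        ≈⟨ *-congˡ (*-identityʳ x) ⟨
    2ℝ ^ b * x ^ 1    ∎)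

  belowLog₂-bounded : ∀ x → 0# < x → Satisfiable (UpperBound (BelowLog₂ x))
  belowLog₂-bounded x (0≤x , _) with archimedean x
  ... | m , x≤m = fromℕ m , bound
    where
    bound : UpperBound (BelowLog₂ x) (fromℕ m)
    bound {y} (a , b , q-1 , y≈ , 2^a≤) = begin
      y                            ≈⟨ y≈ ⟩
      (fromℕ a - fromℕ b) * Q ⁻¹   ≤⟨ *-monoʳ-≤ 0≤Q⁻¹ a-b≤mQ ⟩
      fromℕ m * Q * Q ⁻¹           ≈⟨ *-assoc _ _ _ ⟩
      fromℕ m * (Q * Q ⁻¹)         ≈⟨ *-congˡ (⁻¹-inverseʳ (fromℕ-suc≉0 q-1)) ⟩
      fromℕ m * 1#                 ≈⟨ *-identityʳ _ ⟩
      fromℕ m                      ∎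
      where
      q = suc q-1
      Q = fromℕ q
      0≤Q⁻¹ = 0≤x⇒0≤x⁻¹ (fromℕ-suc≉0 q-1) (0≤fromℕ q)

      a≤b+mq : a ℕ.≤ b ℕ.+ m ℕ.* q
      a≤b+mq = 2^-reflects-≤ a (b ℕ.+ m ℕ.* q) (begin
        2ℝ ^ a                      ≤⟨ 2^a≤ ⟩
        2ℝ ^ b * x ^ q              ≤⟨ *-monoˡ-≤ (^-nonNeg (0≤fromℕ 2) b)
                                        (^-monoˡ-≤ 0≤x (≤-trans x≤m (fromℕ≤2^ m)) q) ⟩
        2ℝ ^ b * (2ℝ ^ m) ^ q       ≈⟨ *-congˡ (^-assocʳ 2ℝ m q) ⟩
        2ℝ ^ b * 2ℝ ^ (m ℕ.* q)     ≈⟨ ^-homo-* 2ℝ b (m ℕ.* q) ⟨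
        2ℝ ^ (b ℕ.+ m ℕ.* q)        ∎)

      a-b≤mQ : fromℕ a - fromℕ b ≤ fromℕ m * Q
      a-b≤mQ = begin
        fromℕ a - fromℕ b                      ≤⟨ +-mono-≤ (fromℕ-mono-≤ a≤b+mq) ≤-refl ⟩
        fromℕ (b ℕ.+ m ℕ.* q) - fromℕ b        ≈⟨ +-congʳ (×-homo-+ 1# b (m ℕ.* q)) ⟩
        fromℕ b + fromℕ (m ℕ.* q) - fromℕ b    ≈⟨ +-comm _ _ ⟩
        - fromℕ b + (fromℕ b + fromℕ (m ℕ.* q)) ≈⟨ +-assoc _ _ _ ⟨
        - fromℕ b + fromℕ b + fromℕ (m ℕ.* q)  ≈⟨ +-congʳ (-‿inverseˡ _) ⟩
        0# + fromℕ (m ℕ.* q)                   ≈⟨ +-identityˡ _ ⟩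
        fromℕ (m ℕ.* q)                        ≈⟨ ×1-homo-* m q ⟩
        fromℕ m * Q                            ∎

  -- Junk value 0# at non-positive arguments.
  log₂ : Carrier → Carrier
  log₂ x with 0# <? x
  ... | yes 0<x = proj₁ (complete (BelowLog₂ x)
                    (belowLog₂-nonempty x 0<x) (belowLog₂-bounded x 0<x))
  ... | no  _   = 0#

record Matroid (n : ℕ) : Set₁ where
  field
    Independent   : Pred (Subset n) 0ℓ
    independent?  : Decidable Independent
    ⊥-independent : Independent ⊥
    hereditary    : ∀ {X Y} → X ⊆ Y → Independent Y → Independent X
    augmentation  : ∀ {X Y} → Independent X → Independent Y → ∣ X ∣ ℕ.< ∣ Y ∣ →
                    ∃[ e ] e ∈ Y × e ∉ X × Independent (X ∪ ⁅ e ⁆)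

  HasRank : ℕ → Set
  HasRank r = (∃[ S ] Independent S × ∣ S ∣ ≡ r) ×
              (∀ {S} → Independent S → ∣ S ∣ ℕ.≤ r)

module _ ⦃ ℝ : Reals ⦄ where
  open Reals ℝ

  SetFunction : ℕ → Set
  SetFunction n = Subset n → Carrier

  module _ {n} (f : SetFunction n) where

    NonNegative : Set
    NonNegative = ∀ X → 0# ≤ f X

    Submodular : Set
    Submodular = ∀ X Y → f (X ∪ Y) + f (X ∩ Y) ≤ f X + f Y

    NonMonotone : Set
    NonMonotone = ∃₂ λ X Y → X ⊂ Y × f Y < f X

    IndependentValue : Matroid n → Pred Carrier 0ℓ
    IndependentValue M v = ∃[ S ] Matroid.Independent M S × v ≈ f S

    IsOptimum : Matroid n → Pred Carrier 0ℓ
    IsOptimum M = IsMaximum (IndependentValue M)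

record Counted (A : Set) : Set where
  constructor counted
  field
    value   : A
    queries : ℕ

open Counted public

pure : ∀ {A} → A → Counted A
pure x = counted x 0

infixl 1 _>>=_
_>>=_ : ∀ {A B} → Counted A → (A → Counted B) → Counted B
c >>= k = counted (value (k (value c))) (queries c ℕ.+ queries (k (value c)))

query : ∀ {A} → A → Counted A
query x = counted x 1

record Choices (n : ℕ) : Set where
  field
    -- order k U is the order in which pass k visits the elements outside U.
    order          : ℕ → Subset n → List (Fin n)
    order-unique   : ∀ k U → Unique (order k U)
    order-complete : ∀ k U e → (e List.∈ order k U) ⇔ (e ∉ U)
    -- Ties go to S₁ when true.  A visit is determined by the pass and the
    -- element, so this and finalTie allow arbitrary tie-breaking.
    tie            : ℕ → Fin n → Bool
    finalTie       : Bool

module _ ⦃ ℝ : Reals ⦄ where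
  open Reals ℝ

  module TwinGreedyFast
    {n : ℕ} (M : Matroid n) (r : ℕ) (f : SetFunction n) (ε : Carrier)
    (choices : Choices n)
    where

    open Matroid M
    open Choices choices
    open AddInfimum _≤_ using (_≤₋_; ≤₋-dec)

    test : Subset n → Counted Bool
    test X = query (does (independent? X))

    eval : Subset n → Counted Carrier
    eval X = query (f X)

    chooseFirst : {A : Set} {_≼_ : Rel A 0ℓ} → (∀ x y → Dec (x ≼ y)) →
                  Bool → A → A → Bool
    chooseFirst _≼?_ t x y =
      if does (x ≼? y) then (if does (y ≼? x) then t else false) else true

    -- ⊥₋ (that is, −∞) is the maximum over the empty set.
    maxSingleton : List (Fin n) → Counted (Carrier ₋)
    maxSingleton []       = pure ⊥₋
    maxSingleton (e ∷ es) = do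
      m ← maxSingleton es
      b ← test ⁅ e ⁆
      if b
        then (do
          v ← eval ⁅ e ⁆
          pure (if does (≤₋-dec _≤?_ m [ v ]) then [ v ] else m))
        else pure m

    Δ : Fin n → Subset n → Counted (Carrier ₋)
    Δ e S = do
      b ← test (S ∪ ⁅ e ⁆)
      if b
        then (do
          x ← eval (⁅ e ⁆ ∪ S)
          y ← eval S
          pure [ x - y ])
        else pure ⊥₋

    State : Set
    State = Subset n × Subset n

    visit : ℕ → Carrier → Fin n → State → Counted State
    visit k τ e (S₁ , S₂) = do
      Δ₁ ← Δ e S₁
      Δ₂ ← Δ e S₂
      pure (if chooseFirst (≤₋-dec _≤?_) (tie k e) Δ₁ Δ₂
        then (if does (≤₋-dec _≤?_ [ τ ] Δ₁) then (S₁ ∪ ⁅ e ⁆ , S₂) else (S₁ , S₂))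
        else (if does (≤₋-dec _≤?_ [ τ ] Δ₂) then (S₁ , S₂ ∪ ⁅ e ⁆) else (S₁ , S₂)))

    visits : ℕ → Carrier → List (Fin n) → State → Counted State
    visits k τ []       s = pure s
    visits k τ (e ∷ es) s = visit k τ e s >>= visits k τ es

    pass : ℕ → Carrier → State → Counted State
    pass k τ (S₁ , S₂) = visits k τ (order k (S₁ ∪ S₂)) (S₁ , S₂)

    threshold : Carrier → ℕ → Carrier
    threshold τmax k = τmax / (1# + ε) ^ k

    cutoff : Carrier → Carrier
    cutoff τmax = ε * τmax / (fromℕ r * (1# + ε))

    -- Loop τmax k s c: entered at pass k in state s, the loop terminates
    -- with outcome c.
    data Loop (τmax : Carrier) : ℕ → State → Counted State → Set where
      stop : ∀ {k s} →
             ¬ (cutoff τmax < threshold τmax k) →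
             Loop τmax k s (pure s)
      next : ∀ {k s c} →
             cutoff τmax < threshold τmax k →
             Loop τmax (suc k) (value (pass k (threshold τmax k) s)) c →
             Loop τmax k s (pass k (threshold τmax k) s >>= λ _ → c)

    better : State → Counted (Subset n)
    better (S₁ , S₂) = do
      v₁ ← eval S₁
      v₂ ← eval S₂
      pure (if chooseFirst _≤?_ finalTie v₁ v₂ then S₁ else S₂)

    -- Run c: the algorithm terminates with outcome c.
    data Run : Counted (Subset n) → Set where
      run : ∀ {τmax c} →
            value (maxSingleton (allFin n)) ≡ [ τmax ] →
            Loop τmax 0 (⊥ , ⊥) c →
            Run (maxSingleton (allFin n) >>= λ _ → c >>= better)

open Reals ⦃ … ⦄ public
  using (Carrier; _≤_; _<_; _+_; _*_; _-_; _/_; 0#; 1#; fromℕ)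
open Logarithm public
  using (log₂)

{-# OPTIONS --safe #-}
module Submission where

-- Approximation ratio.  Fix an independent set O, and let S₁, S₂ be the
-- two disjoint sets grown by the algorithm.  Along the run, sets A₁, B₁,
-- A₂, B₂ are maintained, where Aⱼ ⊆ O consists of elements not yet paid
-- for with respect to Sⱼ, and Bⱼ consists of Sⱼ and the elements already
-- paid for:
--
--   Aⱼ misses S₁ and S₂,  Sⱼ ∪ Aⱼ is independent,
--   Sⱼ ⊆ Bⱼ ⊆ O ∪ Sⱼ  and  O ⊆ Aⱼ ∪ Bⱼ,
--   f B₁ + f B₂ ≤ (2 + ε) (f S₁ + f S₂).
--
-- Suppose that e joins S₁ with gain δ in a pass with threshold τ.  Then
-- δ ≥ τ, and δ is at least the marginal value of e at S₂, if e could have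
-- joined S₂.  By the exchange property (`exchange`), S₁ ∪ A₁ ∪ {e} becomes
-- independent after deleting at most one element a of A₁ (if e ∈ A₁, then
-- e itself leaves A₁ and nothing else does); a and e join B₁ and, if
-- e ∈ A₂, e moves from A₂ to B₂.  The element a lies outside S₁ ∪ S₂ and
-- was rejected in the previous pass although it could have joined S₁, so
-- its marginal value is at most (1 + ε) τ ≤ (1 + ε) δ; in the first pass
-- this holds because τ = τmax bounds all singletons.
-- Distinguishing e ∈ O (where e ∈ A₁ ∪ B₁ already) and e ∉ O (where
-- e ∉ A₂), f B₁ + f B₂ grows by at most (2 + ε) δ (`invariant-add`).  No
-- matching between O and Sⱼ is needed.
--
-- When the thresholds have fallen to the cutoff, each of the at most r
-- elements left in Aⱼ has marginal value at most ε τmax / r, so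
--
--   f O ≤ f (A₁ ∪ B₁) + f (A₂ ∪ B₂) ≤ f B₁ + f B₂ + 2 ε τmax
--       ≤ (2 + ε) (f S₁ + f S₂) + 2 ε f O,
--
-- the first step by submodularity, since A₁ ∪ B₁ and A₂ ∪ B₂ meet exactly
-- in O.  The ratio follows by arithmetic (`ratio-arithmetic`).
--
-- Complexity.  A pass makes at most 6 n queries.  If pass j takes place
-- then (1 + ε) ^ j ≤ (r/ε)².  Choosing a natural number q with
-- 1 ≤ q ε ≤ 2, Bernoulli's inequality gives 2 ≤ (1 + ε) ^ q, hence
-- 2 ^ j ≤ (r/ε) ^ (2 q), and so j ≤ 2 q log₂ (r/ε) ≤ (4/ε) log₂ (r/ε)
-- (`log-bound`).  The same inequality and the Archimedean property show
-- that the loop terminates.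

open import Data.Nat.Base as ℕ using (ℕ)
open import Data.Product.Base using (_×_; ∃; ∃-syntax)
-- The operations of the reals are opened below for a fixed field: the
-- instance-argument versions leave the field to be inferred from the
-- carrier, which is not possible for a variable field.
open import Defs hiding (Carrier; _≤_; _<_; _+_; _*_; _-_; _/_; 0#; 1#; fromℕ)
open import Algebra.Bundles using (CommutativeRing)
import Algebra.Properties.Semiring.Exp as Exp
import Algebra.Properties.Semiring.Mult as Mult
import Algebra.Solver.Ring.NaturalCoefficients.Default as SemiringSolver
open import Data.Bool.Base using (true; false; if_then_else_)
open import Data.Fin.Base as Fin using (Fin)
import Data.Fin.Properties as Fin
open import Data.Fin.Subset
  using (Subset; ⊥; ⁅_⁆; _∈_; _∉_; _⊆_; _∪_; _∩_; ∣_∣; inside; outside)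
  renaming (_-_ to _⊝_)
open import Data.Fin.Subset.Properties
open import Data.List.Base using (List; []; _∷_; allFin; length; lookup)
import Data.List.Membership.Propositional as List
open import Data.List.Membership.Propositional.Properties using (∈-lookup; ∈-allFin)
open import Data.List.Properties using (length-tabulate)
open import Data.List.Relation.Unary.All as All using (All; []; _∷_)
open import Data.List.Relation.Unary.AllPairs using (_∷_)
open import Data.List.Relation.Unary.Any using (here; there)
open import Data.List.Relation.Unary.Unique.Propositional using (Unique)
import Data.Nat.Properties as ℕ
open import Data.Nat.Solver using (module +-*-Solver)
open import Data.Product.Base using (_,_; proj₁; proj₂)
open import Data.Sum.Base as Sum using (_⊎_; inj₁; inj₂; [_,_]′)
import Data.Vec.Base as Vec
open import Function.Base using (_∘_; id; case_of_)
open import Function.Bundles using (Equivalence)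
open import Relation.Binary.Bundles using (DecTotalOrder)
import Relation.Binary.Construct.Add.Infimum.NonStrict as AddInfimum
open import Relation.Binary.Core using (Rel)
open import Relation.Binary.Definitions using (Total; Decidable)
open import Relation.Binary.PropositionalEquality as ≡ using (_≡_; _≢_)
import Relation.Binary.Reasoning.PartialOrder as PartialOrderReasoning
open import Relation.Nullary using (¬_; yes; no; contradiction; does)
open import Relation.Nullary.Construct.Add.Infimum using (_₋; ⊥₋; [_])
open import Relation.Nullary.Decidable using (_×-dec_; ¬?)

-- Finite sets

private
  variable
    n : ℕ
    x y : Fin n
    X Y Z : Subset n

x∈X∪x : ∀ (X : Subset n) x → x ∈ X ∪ ⁅ x ⁆
x∈X∪x X x = q⊆p∪q X ⁅ x ⁆ (x∈⁅x⁆ x)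

∪-⊆ : X ⊆ Z → Y ⊆ Z → X ∪ Y ⊆ Z
∪-⊆ {X = X} {Y = Y} X⊆Z Y⊆Z = [ X⊆Z , Y⊆Z ]′ ∘ x∈p∪q⁻ X Y

⁅x⁆⊆ : x ∈ X → ⁅ x ⁆ ⊆ X
⁅x⁆⊆ {x = x} {X = X} x∈X y∈ = ≡.subst (_∈ X) (≡.sym (x∈⁅y⁆⇒x≡y x y∈)) x∈X

∪-monoˡ : ∀ (Z : Subset n) → X ⊆ Y → X ∪ Z ⊆ Y ∪ Z
∪-monoˡ Z X⊆Y = ∪-⊆ (p⊆p∪q Z ∘ X⊆Y) (q⊆p∪q _ Z)

∈∪⁅⁆⁻ : ∀ (X : Subset n) → y ∈ X ∪ ⁅ x ⁆ → y ∈ X ⊎ y ≡ x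
∈∪⁅⁆⁻ X = Sum.map₂ (x∈⁅y⁆⇒x≡y _) ∘ x∈p∪q⁻ X ⁅ _ ⁆

absorb : x ∈ X → X ∪ ⁅ x ⁆ ≡ X
absorb x∈X = ⊆-antisym (∪-⊆ id (⁅x⁆⊆ x∈X)) (p⊆p∪q _)

x∉X-x : ∀ (X : Subset n) → x ∉ X ⊝ x
x∉X-x {x = Fin.zero}  (_ Vec.∷ X) ()
x∉X-x {x = Fin.suc x} (_ Vec.∷ X) (Vec.there x∈) = x∉X-x X x∈

X-x⊆X : ∀ (X : Subset n) x → X ⊝ x ⊆ X
X-x⊆X X x = p─q⊆p X ⁅ x ⁆

remove-insert : x ∈ X → (X ⊝ x) ∪ ⁅ x ⁆ ≡ X
remove-insert {x = x} {X = X} x∈X = ⊆-antisym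
  (∪-⊆ (X-x⊆X X x) (⁅x⁆⊆ x∈X))
  (λ {y} y∈X → case y Fin.≟ x of λ where
    (yes ≡.refl) → x∈X∪x _ x
    (no y≢x)     → p⊆p∪q _ (x∈p∧x≢y⇒x∈p-y y∈X y≢x))

∣X∪⁅x⁆∣≤1+∣X∣ : ∀ (X : Subset n) x → ∣ X ∪ ⁅ x ⁆ ∣ ℕ.≤ ℕ.suc ∣ X ∣
∣X∪⁅x⁆∣≤1+∣X∣ (inside  Vec.∷ X) Fin.zero    =
  ℕ.s≤s (ℕ.≤-trans (ℕ.≤-reflexive (≡.cong ∣_∣ (∪-identityʳ X))) (ℕ.n≤1+n _))
∣X∪⁅x⁆∣≤1+∣X∣ (outside Vec.∷ X) Fin.zero    =
  ℕ.s≤s (ℕ.≤-reflexive (≡.cong ∣_∣ (∪-identityʳ X)))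
∣X∪⁅x⁆∣≤1+∣X∣ (inside  Vec.∷ X) (Fin.suc x) = ℕ.s≤s (∣X∪⁅x⁆∣≤1+∣X∣ X x)
∣X∪⁅x⁆∣≤1+∣X∣ (outside Vec.∷ X) (Fin.suc x) = ∣X∪⁅x⁆∣≤1+∣X∣ X x

lookup-injective : ∀ {A : Set} {xs : List A} → Unique xs →
                   ∀ {i j} → lookup xs i ≡ lookup xs j → i ≡ j
lookup-injective (_ ∷ _)  {Fin.zero}  {Fin.zero}  _  = ≡.refl
lookup-injective (x∉ ∷ _) {Fin.zero}  {Fin.suc j} eq =
  contradiction eq (All.lookup x∉ (∈-lookup j))
lookup-injective (x∉ ∷ _) {Fin.suc i} {Fin.zero}  eq =
  contradiction (≡.sym eq) (All.lookup x∉ (∈-lookup i))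
lookup-injective (_ ∷ u)  {Fin.suc i} {Fin.suc j} eq =
  ≡.cong Fin.suc (lookup-injective u eq)

unique⇒length≤n : {es : List (Fin n)} → Unique es → length es ℕ.≤ n
unique⇒length≤n u = Fin.injective⇒≤ (lookup-injective u)

-- Arithmetic of the query count

private
  m≤1+pred : ∀ m → m ℕ.≤ ℕ.suc (ℕ.pred m)
  m≤1+pred ℕ.zero    = ℕ.z≤n
  m≤1+pred (ℕ.suc m) = ℕ.≤-refl

-- The left side counts 2 n queries for the largest singleton, 6 n for each
-- of m passes, and 2 for the final comparison.
query-count : ∀ {n} → 1 ℕ.≤ n → ∀ m →
  n ℕ.* 2 ℕ.+ (m ℕ.* (n ℕ.* 6) ℕ.+ 2) ℕ.≤ 10 ℕ.* n ℕ.+ 6 ℕ.* (n ℕ.* ℕ.pred m)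
query-count {n} 1≤n m = begin
  n ℕ.* 2 ℕ.+ (m ℕ.* (n ℕ.* 6) ℕ.+ 2)
    ≤⟨ ℕ.+-monoʳ-≤ (n ℕ.* 2) (ℕ.+-mono-≤
         (ℕ.*-monoˡ-≤ (n ℕ.* 6) (m≤1+pred m)) (ℕ.*-monoˡ-≤ 2 1≤n)) ⟩
  n ℕ.* 2 ℕ.+ (ℕ.suc (ℕ.pred m) ℕ.* (n ℕ.* 6) ℕ.+ n ℕ.* 2)
    ≡⟨ solve 2 (λ n j → n :* con 2 :+ ((con 1 :+ j) :* (n :* con 6) :+ n :* con 2)
         := con 10 :* n :+ con 6 :* (n :* j)) ≡.refl n (ℕ.pred m) ⟩
  10 ℕ.* n ℕ.+ 6 ℕ.* (n ℕ.* ℕ.pred m)  ∎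
  where
  open ℕ.≤-Reasoning
  open +-*-Solver

-- Matroids

module _ {n} (M : Matroid n) where
  open Matroid M

  -- X grows by elements of Y to an independent set at least as large as Y;
  -- k bounds the number of augmentation steps.
  extend : ∀ k {X Y} → Independent X → Independent Y → ∣ Y ∣ ℕ.≤ k ℕ.+ ∣ X ∣ →
           ∃[ Z ] Independent Z × X ⊆ Z × Z ⊆ X ∪ Y × ∣ Y ∣ ℕ.≤ ∣ Z ∣
  extend ℕ.zero {X} X-ind Y-ind Y≤X = X , X-ind , id , p⊆p∪q _ , Y≤X
  extend (ℕ.suc k) {X} {Y} X-ind Y-ind Y≤ with ∣ X ∣ ℕ.<? ∣ Y ∣
  ... | no  X≮Y = X , X-ind , id , p⊆p∪q _ , ℕ.≮⇒≥ X≮Y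
  ... | yes X<Y with augmentation X-ind Y-ind X<Y
  ...   | e , e∈Y , e∉X , Xe-ind with extend k Xe-ind Y-ind
          (ℕ.≤-trans Y≤ (ℕ.≤-trans (ℕ.≤-reflexive (≡.sym (ℕ.+-suc k ∣ X ∣)))
            (ℕ.+-monoʳ-≤ k (p⊂q⇒∣p∣<∣q∣ {p = X} {q = X ∪ ⁅ e ⁆} (p⊆p∪q ⁅ e ⁆ , e , x∈X∪x X e , e∉X)))))
  ...     | Z , Z-ind , Xe⊆Z , Z⊆ , Y≤Z =
            Z , Z-ind , Xe⊆Z ∘ p⊆p∪q ⁅ e ⁆ ,
            ∪-⊆ (∪-⊆ (p⊆p∪q Y) (q⊆p∪q X Y ∘ ⁅x⁆⊆ e∈Y)) (q⊆p∪q X Y) ∘ Z⊆ , Y≤Z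

  -- If S ∪ A and S ∪ {s} are independent, then S ∪ A ∪ {s} becomes
  -- independent after deleting at most one element a of A.  When nothing has to be
  -- deleted, a is taken to be s itself, so that a always exists.
  exchange : ∀ {S A s} → Independent (S ∪ A) → Independent (S ∪ ⁅ s ⁆) →
             ∃[ A′ ] A′ ⊆ A × Independent ((S ∪ ⁅ s ⁆) ∪ A′) ×
             ∃[ a ] (a ∈ A ⊎ a ≡ s) × A ⊆ A′ ∪ ⁅ a ⁆
  exchange {S} {A} {s} SA-ind Ss-ind
    with extend ∣ S ∪ A ∣ Ss-ind SA-ind (ℕ.m≤m+n _ _)
  ... | X , X-ind , Ss⊆X , X⊆ , SA≤X =
    A ∩ X , p∩q⊆p A X , hereditary (∪-⊆ Ss⊆X (p∩q⊆q A X)) X-ind , missing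
    where
    -- X extends S ∪ {s} by elements of S ∪ A, to at least the size of S ∪ A.
    -- If a is the only element of A that X can miss, then A ⊆ (A ∩ X) ∪ {a}.
    ⊆A∩X∪ : ∀ {a} → (∀ {b} → b ∈ A → b ∉ X → b ≡ a) → A ⊆ (A ∩ X) ∪ ⁅ a ⁆
    ⊆A∩X∪ {a} only {b} b∈A with b ∈? X
    ... | yes b∈X = p⊆p∪q _ (x∈p∩q⁺ (b∈A , b∈X))
    ... | no  b∉X with ≡.refl ← only b∈A b∉X = x∈X∪x _ b

    -- Two distinct elements of A outside X would give
    -- X ⊆ (S ∪ A) - a - b + s, which is smaller than S ∪ A.
    at-most-one : ∀ {a b} → a ∈ A → a ∉ X → b ∈ A → b ∉ X → b ≡ a
    at-most-one {a} {b} a∈A a∉X b∈A b∉X with b Fin.≟ a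
    ... | yes b≡a = b≡a
    ... | no  b≢a = contradiction SA≤X (ℕ.<⇒≱ (begin-strict
      ∣ X ∣                          ≤⟨ p⊆q⇒∣p∣≤∣q∣ X⊆Y ⟩
      ∣ (((S ∪ A) ⊝ a) ⊝ b) ∪ ⁅ s ⁆ ∣ ≤⟨ ∣X∪⁅x⁆∣≤1+∣X∣ (((S ∪ A) ⊝ a) ⊝ b) s ⟩
      ℕ.suc ∣ ((S ∪ A) ⊝ a) ⊝ b ∣      ≤⟨ x∈p⇒∣p-x∣<∣p∣ (x∈p∧x≢y⇒x∈p-y (q⊆p∪q S A b∈A) b≢a) ⟩
      ∣ (S ∪ A) ⊝ a ∣                 <⟨ x∈p⇒∣p-x∣<∣p∣ (q⊆p∪q S A a∈A) ⟩
      ∣ S ∪ A ∣                      ∎))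
      where
      open ℕ.≤-Reasoning
      X⊆Y : X ⊆ (((S ∪ A) ⊝ a) ⊝ b) ∪ ⁅ s ⁆
      X⊆Y {x} x∈X with x∈p∪q⁻ (S ∪ ⁅ s ⁆) (S ∪ A) (X⊆ x∈X)
      ... | inj₂ x∈SA = p⊆p∪q _ (x∈p∧x≢y⇒x∈p-y
              (x∈p∧x≢y⇒x∈p-y x∈SA (λ { ≡.refl → a∉X x∈X })) (λ { ≡.refl → b∉X x∈X }))
      ... | inj₁ x∈Ss with ∈∪⁅⁆⁻ S x∈Ss
      ...   | inj₂ ≡.refl = x∈X∪x _ s
      ...   | inj₁ x∈S    = p⊆p∪q _ (x∈p∧x≢y⇒x∈p-y
              (x∈p∧x≢y⇒x∈p-y (p⊆p∪q A x∈S) (λ { ≡.refl → a∉X x∈X })) (λ { ≡.refl → b∉X x∈X }))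

    missing : ∃[ a ] (a ∈ A ⊎ a ≡ s) × A ⊆ (A ∩ X) ∪ ⁅ a ⁆
    missing with Fin.any? (λ a → (a ∈? A) ×-dec ¬? (a ∈? X))
    ... | yes (a , a∈A , a∉X) = a , inj₁ a∈A , ⊆A∩X∪ (at-most-one a∈A a∉X)
    ... | no  none = s , inj₂ ≡.refl ,
            ⊆A∩X∪ (λ b∈A b∉X → contradiction (_ , b∈A , b∉X) none)

-- Ordered fields

module OrderedField ⦃ ℝ : Reals ⦄ where
  open Reals ℝ public
    using (Carrier; _≈_; _≤_; _<_; _+_; _*_; -_; _-_; _/_; _⁻¹; _^_; 0#; 1#; fromℕ;
           ⁻¹-inverseʳ; 0≉1; +-monoʳ-≤; *-nonNeg; archimedean; complete;
           commutativeRing; decTotalOrder; semiring; _≤?_; _<?_)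
  open Logarithm ⦃ ℝ ⦄ public hiding (log₂)
  open CommutativeRing commutativeRing public
    using (commutativeSemiring; +-cong; +-congˡ; +-congʳ; *-congˡ; *-congʳ;
           +-comm; +-assoc; *-comm; *-assoc; +-identityˡ; +-identityʳ;
           *-identityˡ; *-identityʳ; zeroˡ; zeroʳ; -‿inverseʳ; -‿inverseˡ; distribʳ)
    renaming (refl to ≈-refl; sym to ≈-sym; trans to ≈-trans)
  open DecTotalOrder decTotalOrder public
    using (poset; total; antisym)
    renaming (refl to ≤-refl; reflexive to ≤-reflexive; trans to ≤-trans;
              ≤-respˡ-≈ to ≤-respˡ; ≤-respʳ-≈ to ≤-respʳ)
  open Exp semiring public using (^-assocʳ)
  open Mult semiring public using (×-homo-+; ×1-homo-*)
  open SemiringSolver commutativeSemiring public using (solve; con; _:=_; _:+_; _:*_)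
  open PartialOrderReasoning poset public hiding (stop)

  -- Linear arithmetic: x ≤ y holds if x + u and y + l agree, for some l ≤ u.
  -- The equation is one in a commutative semiring, free of subtraction.
  linear : ∀ {l u x y} → l ≤ u → x + u ≈ y + l → x ≤ y
  linear {l} {u} {x} {y} l≤u eq = begin
    x               ≈⟨ +-cancel x ⟨
    (x + u) - u     ≈⟨ +-congʳ eq ⟩
    (y + l) - u     ≤⟨ +-mono-≤ (+-monoʳ-≤ y l≤u) ≤-refl ⟩
    (y + u) - u     ≈⟨ +-cancel y ⟩
    y               ∎
    where
    +-cancel : ∀ z → (z + u) - u ≈ z
    +-cancel z = ≈-trans (+-assoc z u (- u)) (≈-trans (+-congˡ (-‿inverseʳ u)) (+-identityʳ z))

  z≤x-y⇒y+z≤x : ∀ {x y z} → z ≤ x - y → y + z ≤ x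
  z≤x-y⇒y+z≤x {x} {y} {z} z≤ = begin
    y + z        ≤⟨ +-monoʳ-≤ y z≤ ⟩
    y + (x - y)  ≈⟨ +-comm y _ ⟩
    (x - y) + y  ≈⟨ +-assoc x _ _ ⟩
    x + (- y + y)  ≈⟨ +-congˡ (-‿inverseˡ y) ⟩
    x + 0#       ≈⟨ +-identityʳ x ⟩
    x            ∎

  x-y≤z⇒x≤y+z : ∀ {x y z} → x - y ≤ z → x ≤ y + z
  x-y≤z⇒x≤y+z {x} {y} {z} ≤z = begin
    x              ≈⟨ +-identityʳ x ⟨
    x + 0#         ≈⟨ +-congˡ (-‿inverseˡ y) ⟨
    x + (- y + y)  ≈⟨ +-assoc x _ _ ⟨
    (x - y) + y    ≈⟨ +-comm _ y ⟩
    y + (x - y)    ≤⟨ +-monoʳ-≤ y ≤z ⟩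
    y + z          ∎

  ≰⇒≥ : ∀ {x y} → ¬ (x ≤ y) → y ≤ x
  ≰⇒≥ {x} {y} x≰y = [ (λ x≤y → contradiction x≤y x≰y) , id ]′ (total x y)

  ≤⇒≯ : ∀ {x y} → x ≤ y → ¬ (y < x)
  ≤⇒≯ x≤y (y≤x , y≉x) = y≉x (antisym y≤x x≤y)

  ≮⇒≥ : ∀ {x y} → ¬ (x < y) → y ≤ x
  ≮⇒≥ {x} {y} x≮y with y ≤? x
  ... | yes y≤x = y≤x
  ... | no  y≰x = contradiction (≰⇒≥ y≰x , λ x≈y → y≰x (≤-reflexive (≈-sym x≈y))) x≮y

  <⇒≤ : ∀ {x y} → x < y → x ≤ y
  <⇒≤ = proj₁

  >⇒≉0 : ∀ {x} → 0# < x → ¬ (x ≈ 0#)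
  >⇒≉0 (_ , 0≉x) x≈0 = 0≉x (≈-sym x≈0)

  <-≤-trans : ∀ {x y z} → x < y → y ≤ z → x < z
  <-≤-trans (x≤y , x≉y) y≤z = ≤-trans x≤y y≤z ,
    λ x≈z → x≉y (antisym x≤y (≤-trans y≤z (≤-reflexive (≈-sym x≈z))))

  0<1 : 0# < 1#
  0<1 = 0≤1 , 0≉1

  *-cancelˡ-≤ : ∀ {c x y} → 0# < c → c * x ≤ c * y → x ≤ y
  *-cancelˡ-≤ {c} {x} {y} 0<c cx≤cy = begin
    x                 ≈⟨ cancel x ⟨
    c ⁻¹ * (c * x)    ≤⟨ *-monoˡ-≤ (0≤x⇒0≤x⁻¹ (>⇒≉0 0<c) (<⇒≤ 0<c)) cx≤cy ⟩
    c ⁻¹ * (c * y)    ≈⟨ cancel y ⟩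
    y                 ∎
    where
    cancel : ∀ z → c ⁻¹ * (c * z) ≈ z
    cancel z = ≈-trans (≈-sym (*-assoc _ _ _)) (≈-trans
      (*-congʳ (≈-trans (*-comm _ _) (⁻¹-inverseʳ (>⇒≉0 0<c)))) (*-identityˡ z))

  *-pos : ∀ {x y} → 0# < x → 0# < y → 0# < x * y
  *-pos {x} {y} 0<x 0<y = *-nonNeg (<⇒≤ 0<x) (<⇒≤ 0<y) , λ 0≈xy →
    ≤⇒≯ (*-cancelˡ-≤ 0<x (≤-reflexive (≈-trans (≈-sym 0≈xy) (≈-sym (zeroʳ x))))) 0<y

  x/y*y≈x : ∀ x {y} → 0# < y → (x / y) * y ≈ x
  x/y*y≈x x {y} 0<y = ≈-trans (*-assoc x _ y)
    (≈-trans (*-congˡ (≈-trans (*-comm _ y) (⁻¹-inverseʳ (>⇒≉0 0<y)))) (*-identityʳ x))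

  /-nonNeg : ∀ {x y} → 0# ≤ x → 0# < y → 0# ≤ x / y
  /-nonNeg 0≤x 0<y = *-nonNeg 0≤x (0≤x⇒0≤x⁻¹ (>⇒≉0 0<y) (<⇒≤ 0<y))

  bd[x/b] : ∀ {b} d x → 0# < b → b * d * (x / b) ≈ x * d
  bd[x/b] {b} d x 0<b = ≈-trans
    (solve 3 (λ b d z → b :* d :* z := z :* b :* d) ≈-refl b d (x / b))
    (*-congʳ (x/y*y≈x x 0<b))

  bd[y/d] : ∀ b {d} y → 0# < d → b * d * (y / d) ≈ y * b
  bd[y/d] b {d} y 0<d = ≈-trans (*-congʳ (*-comm b d)) (bd[x/b] b y 0<d)

  cross-≤ : ∀ {x b y d} → 0# < b → 0# < d → x * d ≤ y * b → x / b ≤ y / d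
  cross-≤ {x} {b} {y} {d} 0<b 0<d xd≤yb = *-cancelˡ-≤ (*-pos 0<b 0<d)
    (≤-respˡ (≈-sym (bd[x/b] d x 0<b)) (≤-respʳ (≈-sym (bd[y/d] b y 0<d)) xd≤yb))

  cross-≤⁻ : ∀ {x b y d} → 0# < b → 0# < d → x / b ≤ y / d → x * d ≤ y * b
  cross-≤⁻ {x} {b} {y} {d} 0<b 0<d x/b≤y/d =
    ≤-respˡ (bd[x/b] d x 0<b) (≤-respʳ (bd[y/d] b y 0<d)
      (*-monoˡ-≤ (<⇒≤ (*-pos 0<b 0<d)) x/b≤y/d))

  fromℕ-suc-pos : ∀ n → 0# < fromℕ (ℕ.suc n)
  fromℕ-suc-pos n = 0≤fromℕ (ℕ.suc n) , λ eq → fromℕ-suc≉0 n (≈-sym eq)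

  1≤fromℕ : ∀ {n} → 1 ℕ.≤ n → 1# ≤ fromℕ n
  1≤fromℕ {n} 1≤n = ≤-trans (≤-reflexive (≈-sym (+-identityʳ 1#))) (fromℕ-mono-≤ {1} {n} 1≤n)

  fromℕ2≈1+1 : fromℕ 2 ≈ 1# + 1#
  fromℕ2≈1+1 = +-congˡ (+-identityʳ 1#)

  ^-pos : ∀ {x} → 0# < x → ∀ k → 0# < x ^ k
  ^-pos 0<x ℕ.zero    = 0<1
  ^-pos 0<x (ℕ.suc k) = *-pos 0<x (^-pos 0<x k)

  bernoulli : ∀ {x} → 0# ≤ x → ∀ k → 1# + fromℕ k * x ≤ (1# + x) ^ k
  bernoulli {x} 0≤x ℕ.zero = ≤-reflexive (≈-trans (+-congˡ (zeroˡ x)) (+-identityʳ 1#))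
  bernoulli {x} 0≤x (ℕ.suc k) = begin
    1# + (1# + fromℕ k) * x
      ≤⟨ linear (*-nonNeg (0≤fromℕ k) (*-nonNeg 0≤x 0≤x))
           (solve 2 (λ k x → (con 1 :+ (con 1 :+ k) :* x) :+ k :* (x :* x)
                          := (con 1 :+ x) :* (con 1 :+ k :* x) :+ con 0) ≈-refl (fromℕ k) x) ⟩
    (1# + x) * (1# + fromℕ k * x)
      ≤⟨ *-monoˡ-≤ (≤-trans 0≤1 (≤-respˡ (+-identityʳ 1#) (+-monoʳ-≤ 1# 0≤x))) (bernoulli 0≤x k) ⟩
    (1# + x) * (1# + x) ^ k  ∎

  -- Bounds for logarithms

  -- For positive x the with-clause of log₂ takes its first branch.
  log₂-≥ : ∀ {x y} → 0# < x → BelowLog₂ x y → y ≤ log₂ x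
  log₂-≥ {x} 0<x y∈ with 0# <? x
  ... | yes 0<x′ = proj₁ (proj₂ (complete (BelowLog₂ x) (belowLog₂-nonempty x 0<x′)
                     (belowLog₂-bounded x 0<x′))) y∈
  ... | no  0≮x  = contradiction 0<x 0≮x

  -- The rational k / (p + 1) lies below log₂ x.
  2^k≤x^p⇒k≤p*log₂x : ∀ {x} k p → 0# < x → fromℕ 2 ^ k ≤ x ^ ℕ.suc p →
                      fromℕ k ≤ fromℕ (ℕ.suc p) * log₂ x
  2^k≤x^p⇒k≤p*log₂x {x} k p 0<x 2^k≤ = begin
    fromℕ k                  ≈⟨ +-identityʳ _ ⟨
    fromℕ k + 0#             ≈⟨ +-congˡ (≈-trans (≈-sym (+-identityˡ _)) (-‿inverseʳ 0#)) ⟨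
    fromℕ k - 0#             ≈⟨ x/y*y≈x _ (fromℕ-suc-pos p) ⟨
    (fromℕ k - 0#) / P * P   ≈⟨ *-comm _ P ⟩
    P * ((fromℕ k - 0#) / P) ≤⟨ *-monoˡ-≤ (0≤fromℕ (ℕ.suc p)) (log₂-≥ 0<x
                                  (k , 0 , p , ≈-refl , ≤-respʳ (≈-sym (*-identityˡ _)) 2^k≤)) ⟩
    P * log₂ x               ∎
    where P = fromℕ (ℕ.suc p)

  1≤log₂ : ∀ {x} → fromℕ 2 ≤ x → 1# ≤ log₂ x
  1≤log₂ {x} 2≤x = begin
    1#                  ≈⟨ +-identityʳ 1# ⟨
    fromℕ 1             ≤⟨ 2^k≤x^p⇒k≤p*log₂x 1 0 (<-≤-trans (fromℕ-suc-pos 1) 2≤x)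
                             (*-monoʳ-≤ 0≤1 2≤x) ⟩
    fromℕ 1 * log₂ x    ≈⟨ ≈-trans (*-congʳ (+-identityʳ 1#)) (*-identityˡ _) ⟩
    log₂ x              ∎

  -- The least natural number q + 1 with (q + 1) x ≥ 1, found by descending
  -- from an upper bound of 1 / x.
  round-up-inverse : ∀ {x} → 0# < x → x < 1# →
    ∃[ q ] 1# ≤ fromℕ (ℕ.suc q) * x × fromℕ (ℕ.suc q) * x ≤ 1# + 1#
  round-up-inverse {x} 0<x x<1 with archimedean (x ⁻¹)
  ... | N , x⁻¹≤N = search N (begin
      1#              ≈⟨ ⁻¹-inverseʳ (>⇒≉0 0<x) ⟨
      x * x ⁻¹        ≤⟨ *-monoˡ-≤ (<⇒≤ 0<x) x⁻¹≤N ⟩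
      x * fromℕ N     ≈⟨ *-comm x _ ⟩
      fromℕ N * x     ∎)
    where
    search : ∀ k → 1# ≤ fromℕ k * x →
             ∃[ q ] 1# ≤ fromℕ (ℕ.suc q) * x × fromℕ (ℕ.suc q) * x ≤ 1# + 1#
    search ℕ.zero    1≤0 = contradiction 0<1 (≤⇒≯ (≤-respʳ (zeroˡ x) 1≤0))
    search (ℕ.suc k) 1≤  with 1# ≤? fromℕ k * x
    ... | yes 1≤kx = search k 1≤kx
    ... | no  1≰kx = k , 1≤ , (begin
      (1# + fromℕ k) * x     ≈⟨ distribʳ x 1# _ ⟩
      1# * x + fromℕ k * x   ≤⟨ +-mono-≤ (≤-respˡ (≈-sym (*-identityˡ x)) (<⇒≤ x<1)) (≰⇒≥ 1≰kx) ⟩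
      1# + 1#                ∎)

  -- With q as in `round-up-inverse`, 2 ≤ (1 + x) ^ (q + 1), whence
  -- 2 ^ j ≤ y ^ (2 (q + 1)); this makes real exponents unnecessary.
  log-bound : ∀ {x y} j → 0# < x → x < 1# → fromℕ 2 ≤ y → (1# + x) ^ j ≤ y ^ 2 →
              fromℕ j * x ≤ fromℕ 4 * log₂ y
  log-bound {x} {y} j 0<x x<1 2≤y ^j≤y² with round-up-inverse 0<x x<1
  ... | q , 1≤qx , qx≤2 = begin
    fromℕ j * x                             ≤⟨ *-monoʳ-≤ (<⇒≤ 0<x)
                                                (2^k≤x^p⇒k≤p*log₂x j (q ℕ.+ 1 ℕ.* ℕ.suc q) (<-≤-trans (fromℕ-suc-pos 1) 2≤y) 2^j≤) ⟩
    fromℕ (2 ℕ.* ℕ.suc q) * log₂ y * x      ≈⟨ *-congʳ (*-congʳ (×1-homo-* 2 (ℕ.suc q))) ⟩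
    fromℕ 2 * fromℕ (ℕ.suc q) * log₂ y * x  ≈⟨ solve 4 (λ t q l x → t :* q :* l :* x := t :* (q :* x) :* l)
                                                 ≈-refl (fromℕ 2) (fromℕ (ℕ.suc q)) (log₂ y) x ⟩
    fromℕ 2 * (fromℕ (ℕ.suc q) * x) * log₂ y ≤⟨ *-monoʳ-≤ (≤-trans 0≤1 (1≤log₂ 2≤y))
                                                 (*-monoˡ-≤ (0≤fromℕ 2) (≤-respʳ (≈-sym fromℕ2≈1+1) qx≤2)) ⟩
    fromℕ 2 * fromℕ 2 * log₂ y              ≈⟨ *-congʳ (×1-homo-* 2 2) ⟨
    fromℕ 4 * log₂ y                        ∎
    where
    0≤x = <⇒≤ 0<x
    0≤1+x = ≤-trans 0≤1 (≤-respˡ (+-identityʳ 1#) (+-monoʳ-≤ 1# 0≤x))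
    2≤^q : fromℕ 2 ≤ (1# + x) ^ ℕ.suc q
    2≤^q = ≤-trans (≤-respˡ (≈-sym fromℕ2≈1+1) (+-monoʳ-≤ 1# 1≤qx)) (bernoulli 0≤x (ℕ.suc q))

    2^j≤ : fromℕ 2 ^ j ≤ y ^ (2 ℕ.* ℕ.suc q)
    2^j≤ = begin
      fromℕ 2 ^ j                   ≤⟨ ^-monoˡ-≤ (0≤fromℕ 2) 2≤^q j ⟩
      ((1# + x) ^ ℕ.suc q) ^ j      ≈⟨ ^-assocʳ (1# + x) (ℕ.suc q) j ⟩
      (1# + x) ^ (ℕ.suc q ℕ.* j)    ≡⟨ ≡.cong ((1# + x) ^_) (ℕ.*-comm (ℕ.suc q) j) ⟩
      (1# + x) ^ (j ℕ.* ℕ.suc q)    ≈⟨ ^-assocʳ (1# + x) j (ℕ.suc q) ⟨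
      ((1# + x) ^ j) ^ ℕ.suc q      ≤⟨ ^-monoˡ-≤ (^-nonNeg 0≤1+x j) ^j≤y² (ℕ.suc q) ⟩
      (y ^ 2) ^ ℕ.suc q             ≈⟨ ^-assocʳ y 2 (ℕ.suc q) ⟩
      y ^ (2 ℕ.* ℕ.suc q)           ∎

-- Submodular functions

module SubmodularFunction ⦃ ℝ : Reals ⦄ {n} (f : SetFunction n) (submodular : Submodular f) where
  open OrderedField ⦃ ℝ ⦄

  -- Diminishing returns, as the passage of an upper bound c from S to B ⊇ S.
  -- As c ≥ 0, e may lie in B.
  marginal-antitone : ∀ {S B e c} → S ⊆ B → 0# ≤ c →
    f (S ∪ ⁅ e ⁆) ≤ f S + c → f (B ∪ ⁅ e ⁆) ≤ f B + c
  marginal-antitone {S} {B} {e} {c} S⊆B 0≤c fSe≤ with e ∈? B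
  ... | yes e∈B rewrite absorb e∈B = linear 0≤c
          (solve 2 (λ b c → b :+ c := (b :+ c) :+ con 0) ≈-refl (f B) c)
  ... | no  e∉B = linear (+-mono-≤ fSe≤ sub)
          (solve 5 (λ be b s c se → be :+ ((s :+ c) :+ (se :+ b)) := (b :+ c) :+ (se :+ (be :+ s)))
            ≈-refl (f (B ∪ ⁅ e ⁆)) (f B) (f S) c (f (S ∪ ⁅ e ⁆)))
      where
      sub : f (B ∪ ⁅ e ⁆) + f S ≤ f (S ∪ ⁅ e ⁆) + f B
      sub = ≡.subst₂ (λ X Y → f X + f Y ≤ f (S ∪ ⁅ e ⁆) + f B)
        (⊆-antisym
          (∪-⊆ (∪-monoˡ ⁅ e ⁆ S⊆B) (p⊆p∪q ⁅ e ⁆))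
          (∪-⊆ (q⊆p∪q _ B) (p⊆p∪q B ∘ q⊆p∪q S ⁅ e ⁆)))
        (⊆-antisym
          (λ x∈ → let x∈Se , x∈B = x∈p∩q⁻ (S ∪ ⁅ e ⁆) B x∈ in
            [ id , (λ { ≡.refl → contradiction x∈B e∉B }) ]′ (∈∪⁅⁆⁻ S x∈Se))
          (λ x∈S → x∈p∩q⁺ (p⊆p∪q ⁅ e ⁆ x∈S , S⊆B x∈S)))
        (submodular (S ∪ ⁅ e ⁆) B)

  marginal-sum : ∀ {S c} → 0# ≤ c → ∀ k {A B} → S ⊆ B →
    (∀ {a} → a ∈ A → f (S ∪ ⁅ a ⁆) ≤ f S + c) → ∣ A ∣ ℕ.≤ k →
    f (A ∪ B) ≤ f B + fromℕ k * c
  marginal-sum {S} {c} 0≤c k {A} {B} S⊆B small ∣A∣≤k with nonempty? A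
  marginal-sum {S} {c} 0≤c k {A} {B} S⊆B small ∣A∣≤k | no empty
    rewrite Empty-unique empty | ∪-identityˡ B =
      linear (*-nonNeg (0≤fromℕ k) 0≤c)
        (solve 2 (λ b d → b :+ d := (b :+ d) :+ con 0) ≈-refl (f B) (fromℕ k * c))
  marginal-sum {S} {c} 0≤c ℕ.zero {A} {B} S⊆B small ∣A∣≤0 | yes (a , a∈A) =
    contradiction (ℕ.≤-trans (x∈p⇒∣p-x∣<∣p∣ a∈A) ∣A∣≤0) λ ()
  marginal-sum {S} {c} 0≤c (ℕ.suc k) {A} {B} S⊆B small ∣A∣≤1+k | yes (a , a∈A) = begin
    f (A ∪ B)                      ≡⟨ ≡.cong f split ⟩
    f ((A ⊝ a) ∪ (B ∪ ⁅ a ⁆))      ≤⟨ marginal-sum 0≤c k (p⊆p∪q _ ∘ S⊆B) (small ∘ X-x⊆X A a)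
                                        (ℕ.≤-pred (ℕ.≤-trans (x∈p⇒∣p-x∣<∣p∣ a∈A) ∣A∣≤1+k)) ⟩
    f (B ∪ ⁅ a ⁆) + fromℕ k * c    ≤⟨ +-mono-≤ (marginal-antitone S⊆B 0≤c (small a∈A)) ≤-refl ⟩
    f B + c + fromℕ k * c          ≈⟨ solve 3 (λ b c k → b :+ c :+ k :* c := b :+ (con 1 :+ k) :* c)
                                        ≈-refl (f B) c (fromℕ k) ⟩
    f B + (1# + fromℕ k) * c       ∎
    where
    split : A ∪ B ≡ (A ⊝ a) ∪ (B ∪ ⁅ a ⁆)
    split = ≡.trans (≡.cong (_∪ B) (≡.sym (remove-insert a∈A)))
      (≡.trans (∪-assoc (A ⊝ a) ⁅ a ⁆ B) (≡.cong ((A ⊝ a) ∪_) (∪-comm ⁅ a ⁆ B)))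

-- The charging scheme for one of the two sets

module Charging ⦃ ℝ : Reals ⦄ {n} (M : Matroid n)
  (f : SetFunction n) (submodular : Submodular f) where
  open OrderedField ⦃ ℝ ⦄
  open SubmodularFunction f submodular
  open Matroid M

  -- The marginal value of e at S is at most c, unless S ∪ {e} is dependent.
  Small : Carrier → Subset n → Fin n → Set
  Small c S e = Independent (S ∪ ⁅ e ⁆) → f (S ∪ ⁅ e ⁆) ≤ f S + c

  small-mono : ∀ {c S T e} → 0# ≤ c → S ⊆ T → Small c S e → Small c T e
  small-mono {e = e} 0≤c S⊆T small Te-ind =
    marginal-antitone S⊆T 0≤c (small (hereditary (∪-monoˡ ⁅ e ⁆ S⊆T) Te-ind))

  small-weaken : ∀ {c d S e} → c ≤ d → Small c S e → Small d S e
  small-weaken {S = S} c≤d small Se-ind = ≤-trans (small Se-ind) (+-monoʳ-≤ (f S) c≤d)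

  -- A are the elements of O not yet paid for with respect to S, and B
  -- consists of S and those already paid for; S′ is the other set.
  record Side (O S S′ A B : Subset n) : Set where
    field
      A⊆O   : A ⊆ O
      A∉S   : ∀ {a} → a ∈ A → a ∉ S
      A∉S′  : ∀ {a} → a ∈ A → a ∉ S′
      S∪A-independent : Independent (S ∪ A)
      S⊆B   : S ⊆ B
      B⊆O∪S : B ⊆ O ∪ S
      O⊆A∪B : O ⊆ A ∪ B

  -- The value of B′ exceeds that of B by at most p if s ∈ O, and by at most q
  -- otherwise.
  Raise : Subset n → Fin n → Subset n → Carrier → Carrier → Subset n → Set
  Raise O s B p q B′ = (s ∈ O → f B′ ≤ f B + p) × (s ∉ O → f B′ ≤ f B + q)

  module _ {O S S′ A B s} (side : Side O S S′ A B) (s∉S : s ∉ S) (s∉S′ : s ∉ S′) where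
    open Side side

    -- s joins S.
    grow-own : ∀ {δ d} → Independent (S ∪ ⁅ s ⁆) → 0# ≤ δ → δ ≤ d →
      f (S ∪ ⁅ s ⁆) ≤ f S + δ →
      (∀ {a} → a ∉ S → a ∉ S′ → Small d S a) →
      ∃[ A′ ] ∃[ B′ ] Side O (S ∪ ⁅ s ⁆) S′ A′ B′ × Raise O s B d (δ + d) B′
    grow-own {δ} {d} Ss-ind 0≤δ δ≤d gain small with s ∈? A
    ... | yes s∈A = A ⊝ s , B ∪ ⁅ s ⁆ , record
      { A⊆O   = A⊆O ∘ X-x⊆X A s
      ; A∉S   = λ a∈ a∈Ss → [ A∉S (X-x⊆X A s a∈) , (λ { ≡.refl → x∉X-x A a∈ }) ]′ (∈∪⁅⁆⁻ S a∈Ss)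
      ; A∉S′  = A∉S′ ∘ X-x⊆X A s
      ; S∪A-independent = hereditary
          (∪-⊆ (∪-⊆ (p⊆p∪q A) (q⊆p∪q S A ∘ ⁅x⁆⊆ s∈A)) (q⊆p∪q S A ∘ X-x⊆X A s)) S∪A-independent
      ; S⊆B   = ∪-monoˡ ⁅ s ⁆ S⊆B
      ; B⊆O∪S = ∪-⊆ (∪-⊆ (p⊆p∪q _) (q⊆p∪q O _ ∘ p⊆p∪q _) ∘ B⊆O∪S) (q⊆p∪q O _ ∘ q⊆p∪q S _)
      ; O⊆A∪B = λ {x} x∈O → case x Fin.≟ s of λ where
          (yes ≡.refl) → q⊆p∪q (A ⊝ s) _ (x∈X∪x B s)
          (no x≢s) → [ (λ x∈A → p⊆p∪q _ (x∈p∧x≢y⇒x∈p-y x∈A x≢s)) ,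
                       q⊆p∪q (A ⊝ s) _ ∘ p⊆p∪q ⁅ s ⁆ ]′ (x∈p∪q⁻ A B (O⊆A∪B x∈O))
      } ,
      (λ _ → ≤-trans raise (+-monoʳ-≤ (f B) δ≤d)) , (λ s∉O → contradiction (A⊆O s∈A) s∉O)
      where
      raise : f (B ∪ ⁅ s ⁆) ≤ f B + δ
      raise = marginal-antitone S⊆B 0≤δ gain
    ... | no s∉A with exchange M S∪A-independent Ss-ind
    ...   | A′ , A′⊆A , ind′ , a , a∈A⊎a≡s , A⊆A′a = A′ , (B ∪ ⁅ s ⁆) ∪ ⁅ a ⁆ , record
      { A⊆O   = A⊆O ∘ A′⊆A
      ; A∉S   = λ b∈ b∈Ss →
          [ A∉S (A′⊆A b∈) , (λ { ≡.refl → s∉A (A′⊆A b∈) }) ]′ (∈∪⁅⁆⁻ S b∈Ss)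
      ; A∉S′  = A∉S′ ∘ A′⊆A
      ; S∪A-independent = ind′
      ; S⊆B   = p⊆p∪q ⁅ a ⁆ ∘ ∪-monoˡ ⁅ s ⁆ S⊆B
      ; B⊆O∪S = ∪-⊆ (∪-⊆ (∪-⊆ (p⊆p∪q _) (q⊆p∪q O _ ∘ p⊆p∪q _) ∘ B⊆O∪S) (q⊆p∪q O _ ∘ q⊆p∪q S _))
          (⁅x⁆⊆ ([ p⊆p∪q _ ∘ A⊆O , (λ { ≡.refl → q⊆p∪q O _ (x∈X∪x S s) }) ]′ a∈A⊎a≡s))
      ; O⊆A∪B = λ x∈O → [ (λ x∈A → [ p⊆p∪q _ , (λ { ≡.refl → q⊆p∪q A′ _ (x∈X∪x _ a) }) ]′
                                     (∈∪⁅⁆⁻ A′ (A⊆A′a x∈A))) ,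
                          q⊆p∪q A′ _ ∘ p⊆p∪q ⁅ a ⁆ ∘ p⊆p∪q ⁅ s ⁆ ]′ (x∈p∪q⁻ A B (O⊆A∪B x∈O))
      } ,
      -- If s ∈ O, then s ∈ B, since s ∉ A; only a is new in B.
      (λ s∈O → ≡.subst (λ X → f ((B ∪ ⁅ s ⁆) ∪ ⁅ a ⁆) ≤ f X + d)
        (absorb ([ (λ s∈A → contradiction s∈A s∉A) , id ]′ (x∈p∪q⁻ A B (O⊆A∪B s∈O)))) (raise-a a∈A⊎a≡s)) ,
      (λ _ → begin
        f ((B ∪ ⁅ s ⁆) ∪ ⁅ a ⁆)  ≤⟨ raise-a a∈A⊎a≡s ⟩
        f (B ∪ ⁅ s ⁆) + d        ≤⟨ +-mono-≤ (marginal-antitone S⊆B 0≤δ gain) ≤-refl ⟩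
        f B + δ + d              ≈⟨ +-assoc _ _ _ ⟩
        f B + (δ + d)            ∎)
      where
      raise-a : ∀ {a} → a ∈ A ⊎ a ≡ s → f ((B ∪ ⁅ s ⁆) ∪ ⁅ a ⁆) ≤ f (B ∪ ⁅ s ⁆) + d
      raise-a {a} (inj₁ a∈A) = marginal-antitone (p⊆p∪q _ ∘ S⊆B) (≤-trans 0≤δ δ≤d)
        (small (A∉S a∈A) (A∉S′ a∈A)
          (hereditary (∪-⊆ (p⊆p∪q A) (q⊆p∪q S A ∘ ⁅x⁆⊆ a∈A)) S∪A-independent))
      raise-a (inj₂ ≡.refl) rewrite absorb (x∈X∪x B s) = ≤-respˡ (+-identityʳ _)
        (+-monoʳ-≤ (f (B ∪ ⁅ s ⁆)) (≤-trans 0≤δ δ≤d))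

    -- s joins S′, its marginal value at S being at most δ.
    grow-other : ∀ {δ} → 0# ≤ δ → Small δ S s →
      ∃[ A′ ] ∃[ B′ ] Side O S (S′ ∪ ⁅ s ⁆) A′ B′ × Raise O s B δ 0# B′
    grow-other {δ} 0≤δ small with s ∈? A
    ... | yes s∈A = A ⊝ s , B ∪ ⁅ s ⁆ , record
      { A⊆O   = A⊆O ∘ X-x⊆X A s
      ; A∉S   = A∉S ∘ X-x⊆X A s
      ; A∉S′  = λ a∈ a∈S′s → [ A∉S′ (X-x⊆X A s a∈) , (λ { ≡.refl → x∉X-x A a∈ }) ]′ (∈∪⁅⁆⁻ S′ a∈S′s)
      ; S∪A-independent = hereditary (∪-⊆ (p⊆p∪q A) (q⊆p∪q S A ∘ X-x⊆X A s)) S∪A-independent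
      ; S⊆B   = p⊆p∪q _ ∘ S⊆B
      ; B⊆O∪S = ∪-⊆ B⊆O∪S (p⊆p∪q S ∘ A⊆O ∘ ⁅x⁆⊆ s∈A)
      ; O⊆A∪B = λ {x} x∈O → case x Fin.≟ s of λ where
          (yes ≡.refl) → q⊆p∪q (A ⊝ s) _ (x∈X∪x B s)
          (no x≢s) → [ (λ x∈A → p⊆p∪q _ (x∈p∧x≢y⇒x∈p-y x∈A x≢s)) ,
                       q⊆p∪q (A ⊝ s) _ ∘ p⊆p∪q ⁅ s ⁆ ]′ (x∈p∪q⁻ A B (O⊆A∪B x∈O))
      } ,
      (λ _ → marginal-antitone S⊆B 0≤δ
        (small (hereditary (∪-⊆ (p⊆p∪q A) (q⊆p∪q S A ∘ ⁅x⁆⊆ s∈A)) S∪A-independent))) ,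
      (λ s∉O → contradiction (A⊆O s∈A) s∉O)
    ... | no s∉A = A , B , record
      { A⊆O   = A⊆O
      ; A∉S   = A∉S
      ; A∉S′  = λ a∈ a∈S′s → [ A∉S′ a∈ , (λ { ≡.refl → s∉A a∈ }) ]′ (∈∪⁅⁆⁻ S′ a∈S′s)
      ; S∪A-independent = S∪A-independent
      ; S⊆B   = S⊆B
      ; B⊆O∪S = B⊆O∪S
      ; O⊆A∪B = O⊆A∪B
      } ,
      (λ _ → ≤-respˡ (+-identityʳ _) (+-monoʳ-≤ (f B) 0≤δ)) ,
      (λ _ → ≤-reflexive (≈-sym (+-identityʳ _)))

-- Analysis of the algorithm: the invariant

module Analysis ⦃ ℝ : Reals ⦄ {n} (M : Matroid n) (r : ℕ) (f : SetFunction n)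
  (submodular : Submodular f) (ε : Reals.Carrier ℝ) (0≤ε : Reals._≤_ ℝ (Reals.0# ℝ) ε)
  (choices : Choices n) where
  open OrderedField ⦃ ℝ ⦄
  open Charging M f submodular
  open Matroid M
  open TwinGreedyFast M r f ε choices
  open Choices choices
  open AddInfimum _≤_ using (_≤₋_; ≤₋-dec; ≤₋-total; ≤₋-trans; [_])

  1≤1+ε : 1# ≤ 1# + ε
  1≤1+ε = ≤-respˡ (+-identityʳ 1#) (+-monoʳ-≤ 1# 0≤ε)

  0≤1+ε : 0# ≤ 1# + ε
  0≤1+ε = ≤-trans 0≤1 1≤1+ε

  0<1+ε : 0# < 1# + ε
  0<1+ε = <-≤-trans 0<1 1≤1+ε

  x≤[1+ε]x : ∀ {x} → 0# ≤ x → x ≤ (1# + ε) * x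
  x≤[1+ε]x 0≤x = ≤-respˡ (*-identityˡ _) (*-monoʳ-≤ 0≤x 1≤1+ε)

  -- e has marginal value at most c at either set that it could join.
  SmallBoth : Carrier → State → Fin n → Set
  SmallBoth c (S₁ , S₂) e = Small c S₁ e × Small c S₂ e

  -- Elements outside both sets have marginal value at most c at either set
  -- that they could join.
  Bounded : Carrier → State → Set
  Bounded c (S₁ , S₂) = ∀ {e} → e ∉ S₁ → e ∉ S₂ → SmallBoth c (S₁ , S₂) e

  -- What the algorithm has ascertained when it adds e to S rather than to S′:
  -- the gain δ reaches the threshold, and e would not gain more at S′.
  record Gain (τ : Carrier) (e : Fin n) (S S′ : Subset n) : Set where
    field
      δ           : Carrier
      independent : Independent (S ∪ ⁅ e ⁆)
      τ≤δ         : τ ≤ δ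
      gain        : f (S ∪ ⁅ e ⁆) ≈ f S + δ
      maximal     : Small δ S′ e

  -- The charging scheme for both sets, with the bound on the total payment.
  record Invariant (O : Subset n) (s : State) : Set where
    S₁ = proj₁ s
    S₂ = proj₂ s
    field
      disjoint    : ∀ {x} → x ∈ S₁ → x ∉ S₂
      A₁ B₁ A₂ B₂ : Subset n
      side₁       : Side O S₁ S₂ A₁ B₁
      side₂       : Side O S₂ S₁ A₂ B₂
      value-bound : f B₁ + f B₂ ≤ (1# + 1# + ε) * (f S₁ + f S₂)

  invariant-swap : ∀ {O S₁ S₂} → Invariant O (S₁ , S₂) → Invariant O (S₂ , S₁)
  invariant-swap inv = record
    { disjoint    = λ x∈S₂ x∈S₁ → disjoint x∈S₁ x∈S₂
    ; side₁       = side₂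
    ; side₂       = side₁
    ; value-bound = ≤-respˡ (+-comm _ _) (≤-respʳ (*-congˡ (+-comm _ _)) value-bound)
    }
    where open Invariant inv

  invariant-⊥ : ∀ {O} → NonNegative f → Independent O → Invariant O (⊥ , ⊥)
  invariant-⊥ {O} 0≤f O-ind = record
    { disjoint    = λ x∈⊥ → contradiction x∈⊥ ∉⊥
    ; side₁       = side
    ; side₂       = side
    ; value-bound = linear (*-nonNeg (+-nonNeg 0≤1 0≤ε) (+-nonNeg (0≤f ⊥) (0≤f ⊥)))
        (solve 2 (λ e x → x :+ x :+ (con 1 :+ e) :* (x :+ x)
                       := (con 1 :+ con 1 :+ e) :* (x :+ x) :+ con 0) ≈-refl ε (f ⊥))
    }
    where
    +-nonNeg : ∀ {x y} → 0# ≤ x → 0# ≤ y → 0# ≤ x + y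
    +-nonNeg 0≤x 0≤y = ≤-respˡ (+-identityˡ 0#) (+-mono-≤ 0≤x 0≤y)

    side : Side O ⊥ ⊥ O ⊥
    side = record
      { A⊆O   = id
      ; A∉S   = λ _ → ∉⊥
      ; A∉S′  = λ _ → ∉⊥
      ; S∪A-independent = ≡.subst Independent (≡.sym (∪-identityˡ O)) O-ind
      ; S⊆B   = id
      ; B⊆O∪S = q⊆p∪q O ⊥
      ; O⊆A∪B = p⊆p∪q ⊥
      }

  -- With d = (1 + ε) δ, the payment for e and the exchanged element raises
  -- f B₁ + f B₂ by d + δ if e ∈ O and by (δ + d) + 0 otherwise, in either
  -- case by (2 + ε) δ.
  invariant-add : ∀ {O τ S₁ S₂ e} → 0# ≤ τ → e ∉ S₁ → e ∉ S₂ →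
    Bounded ((1# + ε) * τ) (S₁ , S₂) → Gain τ e S₁ S₂ →
    Invariant O (S₁ , S₂) → Invariant O (S₁ ∪ ⁅ e ⁆ , S₂)
  invariant-add {O} {τ} {S₁} {S₂} {e} 0≤τ e∉S₁ e∉S₂ bounded g inv =
    let A₁′ , B₁′ , side₁′ , own∈ , own∉ = grow-own side₁ e∉S₁ e∉S₂ independent 0≤δ
          (x≤[1+ε]x 0≤δ) (≤-reflexive gain)
          (λ a∉S₁ a∉S₂ → small-weaken (*-monoˡ-≤ 0≤1+ε τ≤δ) (proj₁ (bounded a∉S₁ a∉S₂)))
        A₂′ , B₂′ , side₂′ , other∈ , other∉ = grow-other side₂ e∉S₂ e∉S₁ 0≤δ maximal
        raise : f B₁′ + f B₂′ ≤ f B₁ + f B₂ + (δ + d)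
        raise = case e ∈? O of λ where
          (yes e∈O) → ≤-trans (+-mono-≤ (own∈ e∈O) (other∈ e∈O)) (≤-reflexive
            (solve 4 (λ x d y δ → x :+ d :+ (y :+ δ) := x :+ y :+ (δ :+ d)) ≈-refl (f B₁) d (f B₂) δ))
          (no e∉O)  → ≤-trans (+-mono-≤ (own∉ e∉O) (other∉ e∉O)) (≤-reflexive
            (solve 4 (λ x d y δ → x :+ (δ :+ d) :+ (y :+ con 0) := x :+ y :+ (δ :+ d))
              ≈-refl (f B₁) d (f B₂) δ))
    in record
    { disjoint    = λ x∈ x∈S₂ →
        [ (λ x∈S₁ → disjoint x∈S₁ x∈S₂) , (λ { ≡.refl → e∉S₂ x∈S₂ }) ]′ (∈∪⁅⁆⁻ S₁ x∈)
    ; side₁       = side₁′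
    ; side₂       = side₂′
    ; value-bound = begin
        f B₁′ + f B₂′                                 ≤⟨ raise ⟩
        f B₁ + f B₂ + (δ + d)                         ≤⟨ +-mono-≤ value-bound ≤-refl ⟩
        (1# + 1# + ε) * (f S₁ + f S₂) + (δ + d)       ≈⟨ solve 4 (λ ε x y δ →
          (con 1 :+ con 1 :+ ε) :* (x :+ y) :+ (δ :+ (con 1 :+ ε) :* δ)
            := (con 1 :+ con 1 :+ ε) :* (x :+ δ :+ y)) ≈-refl ε (f S₁) (f S₂) δ ⟩
        (1# + 1# + ε) * (f S₁ + δ + f S₂)             ≈⟨ *-congˡ (+-congʳ gain) ⟨
        (1# + 1# + ε) * (f (S₁ ∪ ⁅ e ⁆) + f S₂)       ∎
    }
    where
    open Invariant inv hiding (S₁; S₂)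
    open Gain g
    0≤δ = ≤-trans 0≤τ τ≤δ
    d = (1# + ε) * δ

  -- A single visit

  -- The possible effects of a visit, with the information each one provides.
  data Outcome (τ : Carrier) (e : Fin n) (S₁ S₂ : Subset n) : State → Set where
    skip   : Small τ S₁ e → Small τ S₂ e → Outcome τ e S₁ S₂ (S₁ , S₂)
    first  : Gain τ e S₁ S₂ → Outcome τ e S₁ S₂ (S₁ ∪ ⁅ e ⁆ , S₂)
    second : Gain τ e S₂ S₁ → Outcome τ e S₁ S₂ (S₁ , S₂ ∪ ⁅ e ⁆)

  -- The values that Δ e S can take.
  data Marginal (e : Fin n) (S : Subset n) : Carrier ₋ → Set where
    finite : Independent (S ∪ ⁅ e ⁆) → Marginal e S [ f (⁅ e ⁆ ∪ S) - f S ]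
    -∞     : ¬ Independent (S ∪ ⁅ e ⁆) → Marginal e S ⊥₋

  Δ-marginal : ∀ e S → Marginal e S (value (Δ e S))
  Δ-marginal e S with independent? (S ∪ ⁅ e ⁆)
  ... | yes ind = finite ind
  ... | no ¬ind = -∞ ¬ind

  chooseFirst-true : ∀ {A : Set} {_≼_ : Rel A _} (_≼?_ : Decidable _≼_) → Total _≼_ →
    ∀ t x y → chooseFirst _≼?_ t x y ≡ true → y ≼ x
  chooseFirst-true _≼?_ total t x y eq with x ≼? y | y ≼? x
  ... | _     | yes y≼x = y≼x
  ... | no x⋠y | no y⋠x = [ (λ x≼y → contradiction x≼y x⋠y) , id ]′ (total x y)

  chooseFirst-false : ∀ {A : Set} {_≼_ : Rel A _} (_≼?_ : Decidable _≼_) →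
    ∀ t x y → chooseFirst _≼?_ t x y ≡ false → x ≼ y
  chooseFirst-false _≼?_ t x y eq with x ≼? y
  ... | yes x≼y = x≼y

  marginal⇒small : ∀ {e S D c} → Marginal e S D → D ≤₋ [ c ] → Small c S e
  marginal⇒small {e} {S} (finite _)  [ x≤c ] _ =
    x-y≤z⇒x≤y+z (≡.subst (λ X → f X - f S ≤ _) (∪-comm ⁅ e ⁆ S) x≤c)
  marginal⇒small (-∞ ¬ind)   _ ind = contradiction ind ¬ind

  marginal⇒gain : ∀ {e S S′ D D′ τ} → Marginal e S D → Marginal e S′ D′ →
    D′ ≤₋ D → [ τ ] ≤₋ D → Gain τ e S S′
  marginal⇒gain {e} {S} (finite ind) m′ D′≤D [ τ≤ ] = record
    { independent = ind
    ; τ≤δ         = τ≤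
    ; gain        = ≡.subst (λ X → f X ≈ f S + (f (⁅ e ⁆ ∪ S) - f S)) (∪-comm ⁅ e ⁆ S)
        (antisym (x-y≤z⇒x≤y+z ≤-refl) (z≤x-y⇒y+z≤x ≤-refl))
    ; maximal     = marginal⇒small m′ D′≤D
    }

  visit-outcome : ∀ k τ e S₁ S₂ → Outcome τ e S₁ S₂ (value (visit k τ e (S₁ , S₂)))
  visit-outcome k τ e S₁ S₂ = outcome (Δ-marginal e S₁) (Δ-marginal e S₂)
    where
    _≼?_ = ≤₋-dec _≤?_
    ≼-trans = ≤₋-trans ≤-trans
    ≰⇒≥₋ : ∀ {x y} → ¬ (x ≤₋ y) → y ≤₋ x
    ≰⇒≥₋ {x} {y} x≰y = [ (λ x≤y → contradiction x≤y x≰y) , id ]′ (≤₋-total total x y)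

    outcome : ∀ {D₁ D₂} → Marginal e S₁ D₁ → Marginal e S₂ D₂ → Outcome τ e S₁ S₂
      (if chooseFirst _≼?_ (tie k e) D₁ D₂
        then (if does ([ τ ] ≼? D₁) then (S₁ ∪ ⁅ e ⁆ , S₂) else (S₁ , S₂))
        else (if does ([ τ ] ≼? D₂) then (S₁ , S₂ ∪ ⁅ e ⁆) else (S₁ , S₂)))
    outcome {D₁} {D₂} m₁ m₂ with chooseFirst _≼?_ (tie k e) D₁ D₂ in eq
    outcome {D₁} {D₂} m₁ m₂ | true with [ τ ] ≼? D₁
    ... | yes τ≤D₁ = first (marginal⇒gain m₁ m₂ D₂≤D₁ τ≤D₁)
      where D₂≤D₁ = chooseFirst-true _≼?_ (≤₋-total total) (tie k e) D₁ D₂ eq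
    ... | no  τ≰D₁ = skip (marginal⇒small m₁ (≰⇒≥₋ τ≰D₁)) (marginal⇒small m₂ (≼-trans D₂≤D₁ (≰⇒≥₋ τ≰D₁)))
      where D₂≤D₁ = chooseFirst-true _≼?_ (≤₋-total total) (tie k e) D₁ D₂ eq
    outcome {D₁} {D₂} m₁ m₂ | false with [ τ ] ≼? D₂
    ... | yes τ≤D₂ = second (marginal⇒gain m₂ m₁ D₁≤D₂ τ≤D₂)
      where D₁≤D₂ = chooseFirst-false _≼?_ (tie k e) D₁ D₂ eq
    ... | no  τ≰D₂ = skip (marginal⇒small m₁ (≼-trans D₁≤D₂ (≰⇒≥₋ τ≰D₂))) (marginal⇒small m₂ (≰⇒≥₋ τ≰D₂))
      where D₁≤D₂ = chooseFirst-false _≼?_ (tie k e) D₁ D₂ eq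

  -- A pass

  infix 4 _⊑_ _∉∉_

  -- Componentwise inclusion.
  _⊑_ : State → State → Set
  (S₁ , S₂) ⊑ (T₁ , T₂) = S₁ ⊆ T₁ × S₂ ⊆ T₂

  -- e belongs to neither set.
  _∉∉_ : Fin n → State → Set
  e ∉∉ (S₁ , S₂) = e ∉ S₁ × e ∉ S₂

  bounded-mono : ∀ {c s t} → 0# ≤ c → s ⊑ t → Bounded c s → Bounded c t
  bounded-mono 0≤c (⊑₁ , ⊑₂) bounded e∉₁ e∉₂ =
    let small₁ , small₂ = bounded (e∉₁ ∘ ⊑₁) (e∉₂ ∘ ⊑₂)
    in small-mono 0≤c ⊑₁ small₁ , small-mono 0≤c ⊑₂ small₂

  -- The effect of visiting the elements es, from state s to state t:
  -- elements not in es are not added, and those in es that are not added have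
  -- marginal value at most τ.
  record Progress (O : Subset n) (τ : Carrier) (es : List (Fin n)) (s t : State) : Set where
    field
      invariant : Invariant O t
      grows     : s ⊑ t
      new       : ∀ {x} → x ∉∉ s → ¬ (x List.∈ es) → x ∉∉ t
      visited   : ∀ {e} → e List.∈ es → e ∉∉ t → SmallBoth τ t e

  ∉-∪⁅⁆ : ∀ {x e : Fin n} {S} → x ∉ S → x ≢ e → x ∉ S ∪ ⁅ e ⁆
  ∉-∪⁅⁆ {S = S} x∉S x≢e x∈ = [ x∉S , x≢e ]′ (∈∪⁅⁆⁻ S x∈)

  visit-progress : ∀ {O τ e s} k → 0# ≤ τ → e ∉∉ s → Bounded ((1# + ε) * τ) s →
    Invariant O s → Progress O τ (e ∷ []) s (value (visit k τ e s))
  visit-progress {O} {τ} {e} {S₁ , S₂} k 0≤τ (e∉S₁ , e∉S₂) bounded inv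
    with value (visit k τ e (S₁ , S₂)) | visit-outcome k τ e S₁ S₂
  ... | _ | skip small₁ small₂ = record
    { invariant = inv
    ; grows     = id , id
    ; new       = λ x∉ _ → x∉
    ; visited   = λ { (here ≡.refl) _ → small₁ , small₂ }
    }
  ... | _ | first g = record
    { invariant = invariant-add 0≤τ e∉S₁ e∉S₂ bounded g inv
    ; grows     = p⊆p∪q _ , id
    ; new       = λ (x∉S₁ , x∉S₂) x≢e → ∉-∪⁅⁆ x∉S₁ (x≢e ∘ here) , x∉S₂
    ; visited   = λ { (here ≡.refl) (e∉ , _) → contradiction (x∈X∪x S₁ e) e∉ }
    }
  ... | _ | second g = record
    { invariant = invariant-swap (invariant-add 0≤τ e∉S₂ e∉S₁
        (λ a∉S₂ a∉S₁ → let small₁ , small₂ = bounded a∉S₁ a∉S₂ in small₂ , small₁)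
        g (invariant-swap inv))
    ; grows     = id , p⊆p∪q _
    ; new       = λ (x∉S₁ , x∉S₂) x≢e → x∉S₁ , ∉-∪⁅⁆ x∉S₂ (x≢e ∘ here)
    ; visited   = λ { (here ≡.refl) (_ , e∉) → contradiction (x∈X∪x S₂ e) e∉ }
    }

  -- The bound (1 + ε) τ from the previous pass persists, as marginal values
  -- only decrease; it is what `invariant-add` needs for the exchanged element.
  visits-progress : ∀ {O τ es s} k → 0# ≤ τ → Unique es → All (_∉∉ s) es →
    Bounded ((1# + ε) * τ) s → Invariant O s → Progress O τ es s (value (visits k τ es s))
  visits-progress {es = []} k 0≤τ _ _ bounded inv = record
    { invariant = inv
    ; grows     = id , id
    ; new       = λ x∉ _ → x∉
    ; visited   = λ ()
    }
  visits-progress {τ = τ} {es = e ∷ es} {s} k 0≤τ (e≢es ∷ unique) (e∉s ∷ es∉s) bounded inv = record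
    { invariant = rest.invariant
    ; grows     = proj₁ rest.grows ∘ proj₁ one.grows , proj₂ rest.grows ∘ proj₂ one.grows
    ; new       = λ x∉s x∉es → rest.new (one.new x∉s (λ { (here x≡e) → x∉es (here x≡e) })) (x∉es ∘ there)
    ; visited   = λ where
        (here ≡.refl) (e∉₁ , e∉₂) →
          let small₁ , small₂ = one.visited (here ≡.refl)
                (e∉₁ ∘ proj₁ rest.grows , e∉₂ ∘ proj₂ rest.grows)
          in small-mono 0≤τ (proj₁ rest.grows) small₁ , small-mono 0≤τ (proj₂ rest.grows) small₂
        (there e∈es) → rest.visited e∈es
    }
    where
    module one = Progress (visit-progress k 0≤τ e∉s bounded inv)

    es∉ : All (_∉∉ value (visit k τ e s)) es
    es∉ = All.zipWith (λ (e≢x , x∉s) → one.new x∉s (λ { (here ≡.refl) → e≢x ≡.refl })) (e≢es , es∉s)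

    module rest = Progress (visits-progress {es = es} k 0≤τ unique es∉
      (bounded-mono (*-nonNeg 0≤1+ε 0≤τ) one.grows bounded) one.invariant)

  -- A pass improves the bound on marginal values from (1 + ε) τ to τ.
  pass-spec : ∀ {O τ s} k → 0# ≤ τ → Bounded ((1# + ε) * τ) s → Invariant O s →
    Invariant O (value (pass k τ s)) × Bounded τ (value (pass k τ s))
  pass-spec {s = S₁ , S₂} k 0≤τ bounded inv = invariant , λ e∉₁ e∉₂ →
    visited (Equivalence.from (order-complete k (S₁ ∪ S₂) _)
      ([ e∉₁ ∘ proj₁ grows , e∉₂ ∘ proj₂ grows ]′ ∘ x∈p∪q⁻ S₁ S₂)) (e∉₁ , e∉₂)
    where
    order∉ : All (_∉∉ (S₁ , S₂)) (order k (S₁ ∪ S₂))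
    order∉ = All.tabulate λ e∈ →
      let e∉ = Equivalence.to (order-complete k (S₁ ∪ S₂) _) e∈
      in e∉ ∘ p⊆p∪q S₂ , e∉ ∘ q⊆p∪q S₁ S₂

    open Progress (visits-progress k 0≤τ (order-unique k (S₁ ∪ S₂)) order∉ bounded inv)

  -- The loop

  module _ {τmax} (0≤τmax : 0# ≤ τmax) where

    threshold-nonNeg : ∀ k → 0# ≤ threshold τmax k
    threshold-nonNeg k = /-nonNeg 0≤τmax (^-pos 0<1+ε k)

    threshold-suc : ∀ k → threshold τmax k ≤ (1# + ε) * threshold τmax (ℕ.suc k)
    threshold-suc k = *-cancelˡ-≤ (^-pos 0<1+ε k) (≤-reflexive (begin-equality
      p * (τmax / p)                       ≈⟨ ≈-trans (*-comm _ _) (x/y*y≈x τmax (^-pos 0<1+ε k)) ⟩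
      τmax                                 ≈⟨ x/y*y≈x τmax (^-pos 0<1+ε (ℕ.suc k)) ⟨
      τmax / ((1# + ε) * p) * ((1# + ε) * p) ≈⟨ solve 3 (λ t x p → t :* (x :* p) := p :* (x :* t))
                                              ≈-refl (τmax / ((1# + ε) * p)) (1# + ε) p ⟩
      p * ((1# + ε) * (τmax / ((1# + ε) * p))) ∎))
      where p = (1# + ε) ^ k

    bounded-weaken : ∀ {c d s} → c ≤ d → Bounded c s → Bounded d s
    bounded-weaken c≤d bounded e∉₁ e∉₂ =
      let small₁ , small₂ = bounded e∉₁ e∉₂ in small-weaken c≤d small₁ , small-weaken c≤d small₂

    -- For every pass k, the elements outside both sets have marginal value at
    -- most (1 + ε) times threshold k, that is, the previous threshold.
    loop-spec : ∀ {O k s c} → Loop τmax k s c →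
      Bounded ((1# + ε) * threshold τmax k) s → Invariant O s →
      Bounded ((1# + ε) * cutoff τmax) (value c) × Invariant O (value c)
    loop-spec (stop ≮) bounded inv = bounded-weaken (*-monoˡ-≤ 0≤1+ε (≮⇒≥ ≮)) bounded , inv
    loop-spec {k = k} (next _ loop) bounded inv =
      let inv′ , bounded′ = pass-spec k (threshold-nonNeg k) bounded inv
      in loop-spec loop (bounded-weaken (threshold-suc k) bounded′) inv′

  -- Query counts

  Δ-queries : ∀ e S → queries (Δ e S) ℕ.≤ 3
  Δ-queries e S with independent? (S ∪ ⁅ e ⁆)
  ... | yes _ = ℕ.≤-refl
  ... | no _  = ℕ.s≤s ℕ.z≤n

  visit-queries : ∀ k τ e s → queries (visit k τ e s) ℕ.≤ 6
  visit-queries k τ e (S₁ , S₂) = ℕ.+-mono-≤ (Δ-queries e S₁)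
    (ℕ.≤-trans (ℕ.≤-reflexive (ℕ.+-identityʳ _)) (Δ-queries e S₂))

  visits-queries : ∀ k τ es s → queries (visits k τ es s) ℕ.≤ length es ℕ.* 6
  visits-queries k τ []       s = ℕ.z≤n
  visits-queries k τ (e ∷ es) s = ℕ.+-mono-≤ (visit-queries k τ e s) (visits-queries k τ es _)

  pass-queries : ∀ k τ s → queries (pass k τ s) ℕ.≤ n ℕ.* 6
  pass-queries k τ (S₁ , S₂) = ℕ.≤-trans (visits-queries k τ (order k (S₁ ∪ S₂)) (S₁ , S₂))
    (ℕ.*-monoˡ-≤ 6 (unique⇒length≤n (order-unique k (S₁ ∪ S₂))))

  -- m is the number of passes made.
  loop-queries : ∀ {τmax k s c} → Loop τmax k s c →
    ∃[ m ] queries c ℕ.≤ m ℕ.* (n ℕ.* 6) ×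
           (∀ {j} → j ℕ.< m → cutoff τmax < threshold τmax (j ℕ.+ k))
  loop-queries (stop _) = 0 , ℕ.z≤n , λ ()
  loop-queries {τmax} {k} {s} (next cutoff< loop) =
    let m , queries≤ , running = loop-queries loop in
    ℕ.suc m , ℕ.+-mono-≤ (pass-queries k (threshold τmax k) s) queries≤ , entered running
    where
    entered : ∀ {m} → (∀ {j} → j ℕ.< m → cutoff τmax < threshold τmax (j ℕ.+ ℕ.suc k)) →
              ∀ {j} → j ℕ.< ℕ.suc m → cutoff τmax < threshold τmax (j ℕ.+ k)
    entered running {ℕ.zero}  _           = cutoff<
    entered running {ℕ.suc j} (ℕ.s≤s j<m) =
      ≡.subst (λ i → cutoff τmax < threshold τmax i) (ℕ.+-suc j k) (running j<m)

  -- If pass m + k is not entered, then at most m passes are left from pass k.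
  loop-exists : ∀ {τmax} m {k s} → ¬ (cutoff τmax < threshold τmax (m ℕ.+ k)) →
    ∃ (Loop τmax k s)
  loop-exists ℕ.zero ≮ = _ , stop ≮
  loop-exists {τmax} (ℕ.suc m) {k} {s} ≮ with cutoff τmax <? threshold τmax k
  ... | no  ≮k = _ , stop ≮k
  ... | yes <k = _ , next <k (proj₂ (loop-exists m
          (≡.subst (λ i → ¬ (cutoff τmax < threshold τmax i)) (≡.sym (ℕ.+-suc m k)) ≮)))

  -- The largest singleton value

  maxSingleton-queries : ∀ es → queries (maxSingleton es) ℕ.≤ length es ℕ.* 2
  maxSingleton-queries []       = ℕ.z≤n
  maxSingleton-queries (e ∷ es) with independent? ⁅ e ⁆
  ... | yes _ = ℕ.≤-trans (ℕ.≤-reflexive (ℕ.+-comm _ 2)) (ℕ.+-monoʳ-≤ 2 (maxSingleton-queries es))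
  ... | no _  = ℕ.≤-trans (ℕ.≤-reflexive (ℕ.+-comm _ 1))
                  (ℕ.s≤s (ℕ.≤-trans (maxSingleton-queries es) (ℕ.n≤1+n _)))

  maxSingleton-upper : ∀ {es e} → e List.∈ es → Independent ⁅ e ⁆ →
    [ f ⁅ e ⁆ ] ≤₋ value (maxSingleton es)
  maxSingleton-upper {x ∷ es} e∈ e-ind with independent? ⁅ x ⁆
  maxSingleton-upper {x ∷ es} (here ≡.refl) e-ind | no ¬ind = contradiction e-ind ¬ind
  maxSingleton-upper {x ∷ es} (there e∈) e-ind | no ¬ind = maxSingleton-upper e∈ e-ind
  maxSingleton-upper {x ∷ es} e∈ e-ind | yes ind with ≤₋-dec _≤?_ (value (maxSingleton es)) [ f ⁅ x ⁆ ]
  maxSingleton-upper {x ∷ es} (here ≡.refl) e-ind | yes _ | yes _ = [ ≤-refl ]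
  maxSingleton-upper {x ∷ es} (there e∈) e-ind | yes _ | yes m≤ =
    ≤₋-trans ≤-trans (maxSingleton-upper e∈ e-ind) m≤
  maxSingleton-upper {x ∷ es} (here ≡.refl) e-ind | yes _ | no m≰ =
    [ (λ m≤ → contradiction m≤ m≰) , id ]′ (≤₋-total total _ _)
  maxSingleton-upper {x ∷ es} (there e∈) e-ind | yes _ | no _ = maxSingleton-upper e∈ e-ind

  maxSingleton-attained : ∀ es {τ} → value (maxSingleton es) ≡ [ τ ] →
    ∃[ e ] Independent ⁅ e ⁆ × τ ≡ f ⁅ e ⁆
  maxSingleton-attained (x ∷ es) eq with independent? ⁅ x ⁆
  ... | no _ = maxSingleton-attained es eq
  ... | yes ind with ≤₋-dec _≤?_ (value (maxSingleton es)) [ f ⁅ x ⁆ ]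
  maxSingleton-attained (x ∷ es) ≡.refl | yes ind | yes _ = x , ind , ≡.refl
  maxSingleton-attained (x ∷ es) eq     | yes ind | no _ = maxSingleton-attained es eq

  -- The better of the two sets

  better-either : ∀ (P : Subset n → Set) S₁ S₂ → P S₁ → P S₂ → P (value (better (S₁ , S₂)))
  better-either P S₁ S₂ p₁ p₂ with chooseFirst _≤?_ finalTie (f S₁) (f S₂)
  ... | true  = p₁
  ... | false = p₂

  better-best : ∀ S₁ S₂ → let v = f (value (better (S₁ , S₂))) in f S₁ ≤ v × f S₂ ≤ v
  better-best S₁ S₂ with chooseFirst _≤?_ finalTie (f S₁) (f S₂) in eq
  ... | true  = ≤-refl , chooseFirst-true _≤?_ total finalTie _ _ eq
  ... | false = chooseFirst-false _≤?_ finalTie _ _ eq , ≤-refl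

-- The guarantees

module Guarantees ⦃ ℝ : Reals ⦄ {n} (M : Matroid n) (r : ℕ) (rank : Matroid.HasRank M r)
  (1≤r : 1 ℕ.≤ r) (f : SetFunction n) (nonNegative : NonNegative f) (submodular : Submodular f)
  (ε : Reals.Carrier ℝ) (0<ε : Reals._<_ ℝ (Reals.0# ℝ) ε)
  (ε<1 : Reals._<_ ℝ ε (Reals.1# ℝ)) (choices : Choices n) where
  open OrderedField ⦃ ℝ ⦄
  open SubmodularFunction f submodular
  open Charging M f submodular
  open Matroid M
  open TwinGreedyFast M r f ε choices
  open Analysis M r f submodular ε (proj₁ 0<ε) choices
  open AddInfimum _≤_ using (_≤₋_; [≤]-injective)

  0≤ε : 0# ≤ ε
  0≤ε = <⇒≤ 0<ε

  -- The rank as a real number.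
  R : Carrier
  R = fromℕ r

  0<R : 0# < R
  0<R = <-≤-trans 0<1 (1≤fromℕ 1≤r)

  0<R[1+ε] : 0# < R * (1# + ε)
  0<R[1+ε] = *-pos 0<R 0<1+ε

  private
    basis : Subset n
    basis = proj₁ (proj₁ rank)

    basis-independent : Independent basis
    basis-independent = proj₁ (proj₂ (proj₁ rank))

    1≤∣basis∣ : 1 ℕ.≤ ∣ basis ∣
    1≤∣basis∣ = ≡.subst (1 ℕ.≤_) (≡.sym (proj₂ (proj₂ (proj₁ rank)))) 1≤r

  singleton : ∃[ e ] Independent ⁅ e ⁆
  singleton with nonempty? basis
  ... | yes (e , e∈S) = e , hereditary (⁅x⁆⊆ e∈S) basis-independent
  ... | no empty      = contradiction
    (≡.subst (1 ℕ.≤_) (≡.trans (≡.cong ∣_∣ (Empty-unique empty)) (∣⊥∣≡0 n)) 1≤∣basis∣) λ ()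

  1≤n : 1 ℕ.≤ n
  1≤n = ℕ.≤-trans 1≤∣basis∣ (∣p∣≤n basis)

  cutoff-nonNeg : ∀ {τ} → 0# ≤ τ → 0# ≤ cutoff τ
  cutoff-nonNeg 0≤τ = /-nonNeg (*-nonNeg 0≤ε 0≤τ) 0<R[1+ε]

  -- Termination

  -- Pass K is not entered once r (1 + ε) ≤ ε (1 + ε) ^ K.  As
  -- K ε ≤ (1 + ε) ^ K, it suffices that K ≥ r (1 + ε) / ε².
  loop-terminates : ∀ {τ} → 0# ≤ τ → ∃ (Loop τ 0 (⊥ , ⊥))
  loop-terminates {τ} 0≤τ with archimedean (R * (1# + ε) / (ε * ε))
  ... | K , ≤K = loop-exists K (≡.subst (λ i → ¬ (cutoff τ < threshold τ i)) (≡.sym (ℕ.+-identityʳ K))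
    (≤⇒≯ (cross-≤ (^-pos 0<1+ε K) 0<R[1+ε] (begin
      τ * (R * (1# + ε))         ≤⟨ *-monoˡ-≤ 0≤τ enough ⟩
      τ * (ε * (1# + ε) ^ K)     ≈⟨ solve 3 (λ t e p → t :* (e :* p) := e :* t :* p) ≈-refl τ ε _ ⟩
      ε * τ * (1# + ε) ^ K       ∎))))
    where
    enough : R * (1# + ε) ≤ ε * (1# + ε) ^ K
    enough = begin
      R * (1# + ε)                            ≈⟨ x/y*y≈x _ (*-pos 0<ε 0<ε) ⟨
      R * (1# + ε) / (ε * ε) * (ε * ε)        ≤⟨ *-monoʳ-≤ (*-nonNeg 0≤ε 0≤ε) ≤K ⟩
      fromℕ K * (ε * ε)                       ≈⟨ solve 2 (λ k e → k :* (e :* e) := e :* (k :* e)) ≈-refl (fromℕ K) ε ⟩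
      ε * (fromℕ K * ε)                       ≤⟨ *-monoˡ-≤ 0≤ε (≤-trans
        (≤-respˡ (+-identityˡ _) (+-mono-≤ 0≤1 ≤-refl)) (bernoulli 0≤ε K)) ⟩
      ε * (1# + ε) ^ K                        ∎

  run-exists : ∃ Run
  run-exists with value (maxSingleton (allFin n)) in eq
    | maxSingleton-upper (∈-allFin (proj₁ singleton)) (proj₂ singleton)
  ... | [ τ ] | AddInfimum.[ fe≤τ ] =
    _ , run eq (proj₂ (loop-terminates (≤-trans (nonNegative _) fe≤τ)))

  -- Approximation ratio

  -- At the empty sets, marginal values are at most τ, which is the threshold
  -- of pass 0.
  initially-bounded : ∀ {τ} → value (maxSingleton (allFin n)) ≡ [ τ ] → 0# ≤ τ →
    Bounded ((1# + ε) * threshold τ 0) (⊥ , ⊥)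
  initially-bounded {τ} eq 0≤τ _ _ = small , small
    where
    small : ∀ {e} → Small ((1# + ε) * threshold τ 0) ⊥ e
    small {e} ind rewrite ∪-identityˡ ⁅ e ⁆ = begin
      f ⁅ e ⁆                              ≤⟨ [≤]-injective (≡.subst ([ f ⁅ e ⁆ ] ≤₋_) eq
                                                (maxSingleton-upper (∈-allFin e) ind)) ⟩
      τ                                    ≈⟨ x/y*y≈x τ 0<1 ⟨
      threshold τ 0 * 1#                   ≈⟨ *-identityʳ _ ⟩
      threshold τ 0                        ≤⟨ x≤[1+ε]x (threshold-nonNeg 0≤τ 0) ⟩
      (1# + ε) * threshold τ 0             ≈⟨ +-identityˡ _ ⟨
      0# + (1# + ε) * threshold τ 0        ≤⟨ +-mono-≤ (nonNegative ⊥) ≤-refl ⟩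
      f ⊥ + (1# + ε) * threshold τ 0       ∎

  τmax-nonNeg : ∀ {τ} → value (maxSingleton (allFin n)) ≡ [ τ ] → 0# ≤ τ
  τmax-nonNeg eq with maxSingleton-attained (allFin n) eq
  ... | e , _ , ≡.refl = nonNegative ⁅ e ⁆

  final-spec : ∀ {O τ c} → Independent O → value (maxSingleton (allFin n)) ≡ [ τ ] → Loop τ 0 (⊥ , ⊥) c →
    Bounded ((1# + ε) * cutoff τ) (value c) × Invariant O (value c)
  final-spec O-ind eq loop = loop-spec 0≤τ loop (initially-bounded eq 0≤τ) (invariant-⊥ nonNegative O-ind)
    where 0≤τ = τmax-nonNeg eq

  invariant⇒independent : ∀ {O s} → Invariant O s → Independent (proj₁ s) × Independent (proj₂ s)
  invariant⇒independent inv =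
    hereditary (p⊆p∪q _) (Side.S∪A-independent side₁) ,
    hereditary (p⊆p∪q _) (Side.S∪A-independent side₂)
    where open Invariant inv

  result-independent : ∀ {result} → Run result → Independent (value result)
  result-independent (run {c = c} eq loop) =
    let ind₁ , ind₂ = invariant⇒independent (proj₂ (final-spec ⊥-independent eq loop))
    in better-either Independent (proj₁ (value c)) (proj₂ (value c)) ind₁ ind₂

  -- A has at most r elements, being independent, and each of them has
  -- marginal value at most θ at S ⊆ B.
  leftover : ∀ {O S S′ A B θ} → 0# ≤ θ → Side O S S′ A B →
    (∀ {a} → a ∉ S → a ∉ S′ → Small θ S a) → f (A ∪ B) ≤ f B + R * θ
  leftover {S = S} {A = A} 0≤θ side small = marginal-sum 0≤θ r S⊆B
    (λ a∈A → small (A∉S a∈A) (A∉S′ a∈A)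
      (hereditary (∪-⊆ (p⊆p∪q A) (q⊆p∪q S A ∘ ⁅x⁆⊆ a∈A)) S∪A-independent))
    (proj₂ rank (hereditary (q⊆p∪q S A) S∪A-independent))
    where open Side side

  -- A₁ ∪ B₁ and A₂ ∪ B₂ meet in O, because S₁ and S₂ are disjoint.
  optimum-covered : ∀ {O s} (inv : Invariant O s) → let open Invariant inv in
    f O ≤ f (A₁ ∪ B₁) + f (A₂ ∪ B₂)
  optimum-covered {O} {S₁ , S₂} inv = begin
    f O                                       ≈⟨ +-identityˡ _ ⟨
    0# + f O                                  ≤⟨ +-mono-≤ (nonNegative _) ≤-refl ⟩
    f (T₁ ∪ T₂) + f O                           ≡⟨ ≡.cong (λ Z → f (T₁ ∪ T₂) + f Z) T₁∩T₂≡O ⟨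
    f (T₁ ∪ T₂) + f (T₁ ∩ T₂)                     ≤⟨ submodular T₁ T₂ ⟩
    f T₁ + f T₂                                 ∎
    where
    open Invariant inv hiding (S₁; S₂)
    module one = Side side₁
    module two = Side side₂
    T₁ = A₁ ∪ B₁
    T₂ = A₂ ∪ B₂
    T₁⊆ : T₁ ⊆ O ∪ S₁
    T₁⊆ = ∪-⊆ (p⊆p∪q S₁ ∘ one.A⊆O) one.B⊆O∪S
    T₂⊆ : T₂ ⊆ O ∪ S₂
    T₂⊆ = ∪-⊆ (p⊆p∪q S₂ ∘ two.A⊆O) two.B⊆O∪S
    T₁∩T₂≡O : T₁ ∩ T₂ ≡ O
    T₁∩T₂≡O = ⊆-antisym
      (λ x∈ → let x∈T₁ , x∈T₂ = x∈p∩q⁻ T₁ T₂ x∈ in case x∈p∪q⁻ O S₁ (T₁⊆ x∈T₁) of λ where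
        (inj₁ x∈O)  → x∈O
        (inj₂ x∈S₁) → [ id , (λ x∈S₂ → contradiction x∈S₂ (disjoint x∈S₁)) ]′ (x∈p∪q⁻ O S₂ (T₂⊆ x∈T₂)))
      (λ x∈O → x∈p∩q⁺ (one.O⊆A∪B x∈O , two.O⊆A∪B x∈O))

  R*[1+ε]*cutoff : ∀ τ → R * ((1# + ε) * cutoff τ) ≈ ε * τ
  R*[1+ε]*cutoff τ = ≈-trans
    (solve 3 (λ r p c → r :* (p :* c) := c :* (r :* p)) ≈-refl R (1# + ε) (cutoff τ))
    (x/y*y≈x (ε * τ) 0<R[1+ε])

  optimum-bound : ∀ {O τ s v} → 0# ≤ τ → τ ≤ f O → Bounded ((1# + ε) * cutoff τ) s → Invariant O s →
    f (proj₁ s) ≤ v → f (proj₂ s) ≤ v →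
    f O ≤ (1# + 1# + ε) * (v + v) + (ε * f O + ε * f O)
  optimum-bound {O} {τ} {S₁ , S₂} {v} 0≤τ τ≤fO bounded inv fS₁≤v fS₂≤v = begin
    f O                                    ≤⟨ optimum-covered inv ⟩
    f (A₁ ∪ B₁) + f (A₂ ∪ B₂)              ≤⟨ +-mono-≤
      (leftover 0≤θ side₁ (λ a∉S₁ a∉S₂ → proj₁ (bounded a∉S₁ a∉S₂)))
      (leftover 0≤θ side₂ (λ a∉S₂ a∉S₁ → proj₂ (bounded a∉S₁ a∉S₂))) ⟩
    (f B₁ + R * θ) + (f B₂ + R * θ)        ≤⟨ +-mono-≤ (+-monoʳ-≤ (f B₁) Rθ≤) (+-monoʳ-≤ (f B₂) Rθ≤) ⟩
    (f B₁ + ε * f O) + (f B₂ + ε * f O)    ≈⟨ solve 3 (λ x y z → (x :+ z) :+ (y :+ z) := (x :+ y) :+ (z :+ z))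
                                                ≈-refl (f B₁) (f B₂) (ε * f O) ⟩
    (f B₁ + f B₂) + (ε * f O + ε * f O)    ≤⟨ +-mono-≤ (≤-trans value-bound
      (*-monoˡ-≤ 0≤2+ε (+-mono-≤ fS₁≤v fS₂≤v))) ≤-refl ⟩
    (1# + 1# + ε) * (v + v) + (ε * f O + ε * f O) ∎
    where
    open Invariant inv hiding (S₁; S₂)
    θ = (1# + ε) * cutoff τ
    0≤θ = *-nonNeg 0≤1+ε (cutoff-nonNeg 0≤τ)
    Rθ≤ : R * θ ≤ ε * f O
    Rθ≤ = ≤-respˡ (≈-sym (R*[1+ε]*cutoff τ)) (*-monoˡ-≤ 0≤ε τ≤fO)
    0≤2+ε : 0# ≤ 1# + 1# + ε
    0≤2+ε = ≤-trans 0≤1 (≤-trans 1≤1+ε (+-mono-≤ (≤-respˡ (+-identityʳ 1#) (+-monoʳ-≤ 1# 0≤1)) ≤-refl))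

  -- Both sides are multiplied by c = 4 + 2 ε; the claim then follows from
  -- c (1/4 - ε) = 1 + ε/2 - 4 ε - 2 ε² ≤ 1 - 2 ε.  In the proof, c ε F is
  -- added to both sides, and q = 1/4.
  ratio-arithmetic : ∀ {F v} → 0# ≤ F →
    F ≤ (1# + 1# + ε) * (v + v) + (ε * F + ε * F) → (1# / fromℕ 4 - ε) * F ≤ v
  ratio-arithmetic {F} {v} 0≤F F≤ = *-cancelˡ-≤ 0<c (linear bound (≈-trans (+-comm _ _)
    (≈-trans (+-assoc _ _ _) (+-congˡ (+-comm _ _)))))
    where
    q = 1# / fromℕ 4
    p = q - ε
    c = (1# + 1# + ε) * (1# + 1#)
    0<1+1 : 0# < 1# + 1#
    0<1+1 = <-≤-trans 0<1 (≤-respˡ (+-identityʳ 1#) (+-monoʳ-≤ 1# 0≤1))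
    0<c : 0# < c
    0<c = *-pos (<-≤-trans 0<1+1 (≤-respˡ (+-identityʳ _) (+-monoʳ-≤ _ 0≤ε))) 0<1+1

    q*4≈1 : q * fromℕ 4 ≈ 1#
    q*4≈1 = x/y*y≈x 1# (fromℕ-suc-pos 3)
    p+ε≈q : p + ε ≈ q
    p+ε≈q = ≈-trans (+-assoc _ _ _) (≈-trans (+-congˡ (-‿inverseˡ ε)) (+-identityʳ q))
    0≤q : 0# ≤ q
    0≤q = /-nonNeg 0≤1 (fromℕ-suc-pos 3)
    q≤1 : q ≤ 1#
    q≤1 = ≤-respˡ (*-identityʳ q) (≤-respʳ q*4≈1 (*-monoˡ-≤ 0≤q (1≤fromℕ {4} (ℕ.s≤s ℕ.z≤n))))
    0≤εF = *-nonNeg 0≤ε 0≤F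
    0≤ε²F+ : 0# ≤ ε * (ε * F) + ε * (ε * F)
    0≤ε²F+ = ≤-respˡ (+-identityˡ 0#) (+-mono-≤ (*-nonNeg 0≤ε 0≤εF) (*-nonNeg 0≤ε 0≤εF))

    bound : c * (p * F) + c * (ε * F) ≤ c * v + c * (ε * F)
    bound = begin
      c * (p * F) + c * (ε * F)
        ≈⟨ solve 4 (λ c p e x → c :* (p :* x) :+ c :* (e :* x) := c :* (p :+ e) :* x) ≈-refl c p ε F ⟩
      c * (p + ε) * F
        ≈⟨ *-congʳ (*-congˡ p+ε≈q) ⟩
      c * q * F
        ≈⟨ solve 3 (λ e q x → (con 1 :+ con 1 :+ e) :* (con 1 :+ con 1) :* q :* x
             := q :* (con 1 :+ (con 1 :+ (con 1 :+ (con 1 :+ con 0)))) :* x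
                :+ (q :* (e :* x) :+ q :* (e :* x))) ≈-refl ε q F ⟩
      q * fromℕ 4 * F + (q * (ε * F) + q * (ε * F))
        ≈⟨ +-congʳ (≈-trans (*-congʳ q*4≈1) (*-identityˡ F)) ⟩
      F + (q * (ε * F) + q * (ε * F))
        ≤⟨ +-mono-≤ F≤ (+-mono-≤ (*-monoʳ-≤ 0≤εF q≤1) (*-monoʳ-≤ 0≤εF q≤1)) ⟩
      (1# + 1# + ε) * (v + v) + (ε * F + ε * F) + (1# * (ε * F) + 1# * (ε * F))
        ≤⟨ linear 0≤ε²F+ (solve 3 (λ e v x →
             (con 1 :+ con 1 :+ e) :* (v :+ v) :+ (e :* x :+ e :* x) :+ (con 1 :* (e :* x) :+ con 1 :* (e :* x))
               :+ (e :* (e :* x) :+ e :* (e :* x))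
             := ((con 1 :+ con 1 :+ e) :* (con 1 :+ con 1) :* v
               :+ (con 1 :+ con 1 :+ e) :* (con 1 :+ con 1) :* (e :* x)) :+ con 0) ≈-refl ε v F) ⟩
      c * v + c * (ε * F) ∎

  result-ratio : ∀ {result} → Run result → ∀ OPT → IsOptimum f M OPT →
    (1# / fromℕ 4 - ε) * OPT ≤ f (value result)
  result-ratio (run {τ} {c} eq loop) OPT ((O , O-ind , OPT≈fO) , maximal) =
    ≤-respˡ (*-congˡ (≈-sym OPT≈fO)) (ratio-arithmetic (nonNegative O)
      (optimum-bound (τmax-nonNeg eq) τ≤fO bounded inv (proj₁ best) (proj₂ best)))
    where
    bounded = proj₁ (final-spec O-ind eq loop)
    inv = proj₂ (final-spec O-ind eq loop)
    best = better-best (proj₁ (value c)) (proj₂ (value c))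
    τ≤fO : τ ≤ f O
    τ≤fO with maxSingleton-attained (allFin n) eq
    ... | e , e-ind , ≡.refl = ≤-respʳ OPT≈fO (maximal (⁅ e ⁆ , e-ind , ≈-refl))

  -- Complexity

  -- The condition for entering pass j reads ε (1 + ε) ^ j < r (1 + ε), and
  -- 1 + ε ≤ 2 ≤ r/ε.  Here τ ≠ 0, since otherwise no pass is entered.
  running⇒power : ∀ {τ} j → 0# ≤ τ → fromℕ 2 ≤ R / ε → cutoff τ < threshold τ j →
    (1# + ε) ^ j ≤ (R / ε) ^ 2
  running⇒power {τ} j 0≤τ 2≤ρ running = *-cancelˡ-≤ 0<ε (*-cancelˡ-≤ 0<τ (begin
    τ * (ε * p)               ≈⟨ solve 3 (λ t e p → t :* (e :* p) := e :* t :* p) ≈-refl τ ε p ⟩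
    ε * τ * p                 ≤⟨ cross-≤⁻ 0<R[1+ε] (^-pos 0<1+ε j) (<⇒≤ running) ⟩
    τ * (R * (1# + ε))        ≤⟨ *-monoˡ-≤ 0≤τ (begin
      R * (1# + ε)              ≤⟨ *-monoˡ-≤ (<⇒≤ 0<R) (≤-trans
                                     (≤-respʳ (≈-sym fromℕ2≈1+1) (+-monoʳ-≤ 1# (<⇒≤ ε<1))) 2≤ρ) ⟩
      R * ρ                     ≈⟨ *-congʳ (x/y*y≈x R 0<ε) ⟨
      ρ * ε * ρ                 ≈⟨ solve 2 (λ ρ e → ρ :* e :* ρ := e :* (ρ :* (ρ :* con 1))) ≈-refl ρ ε ⟩
      ε * ρ ^ 2                 ∎) ⟩
    τ * (ε * ρ ^ 2)           ∎))
    where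
    ρ = R / ε
    p = (1# + ε) ^ j
    0<τ : 0# < τ
    0<τ = 0≤τ , λ 0≈τ → ≤⇒≯ (begin
      threshold τ j    ≈⟨ *-congʳ 0≈τ ⟨
      0# * p ⁻¹        ≈⟨ zeroˡ _ ⟩
      0#               ≤⟨ cutoff-nonNeg 0≤τ ⟩
      cutoff τ         ∎) running

  -- The hypothesis says that passes 0, ..., m - 1 are entered.
  passes-bound : ∀ {τ} m → 0# ≤ τ → fromℕ 2 ≤ R / ε →
    (∀ {j} → j ℕ.< m → cutoff τ < threshold τ (j ℕ.+ 0)) →
    fromℕ (ℕ.pred m) * ε ≤ fromℕ 4 * log₂ (R / ε)
  passes-bound ℕ.zero _ 2≤y _ = ≤-respˡ (≈-sym (zeroˡ ε))
    (*-nonNeg (0≤fromℕ 4) (≤-trans 0≤1 (1≤log₂ 2≤y)))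
  passes-bound {τ} (ℕ.suc j) 0≤τ 2≤y running = log-bound j 0<ε ε<1 2≤y
    (running⇒power j 0≤τ 2≤y (≡.subst (λ i → cutoff τ < threshold τ i) (ℕ.+-identityʳ j) (running ℕ.≤-refl)))

  -- With L = log₂ (r/ε) and j = m - 1, where m ≥ 1 is the number of passes
  -- (j = 0 if there is none), the count is at most 10 n + 6 n j, and this is
  -- at most 34 (n/ε) L because ε ≤ 1 ≤ L and j ε ≤ 4 L.
  result-queries : ∀ {result} → Run result → fromℕ 2 ≤ R / ε →
    fromℕ (queries result) ≤ fromℕ 34 * (fromℕ n / ε * log₂ (R / ε))
  result-queries (run {τ} {c} eq loop) 2≤y with loop-queries loop
  ... | m , queries≤ , running = *-cancelˡ-≤ 0<ε (begin
    ε * fromℕ Q                             ≤⟨ *-monoˡ-≤ 0≤ε (fromℕ-mono-≤ Q≤) ⟩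
    ε * fromℕ (10 ℕ.* n ℕ.+ 6 ℕ.* (n ℕ.* j))
      ≈⟨ *-congˡ (≈-trans (×-homo-+ 1# (10 ℕ.* n) _) (+-cong (×1-homo-* 10 n)
           (≈-trans (×1-homo-* 6 (n ℕ.* j)) (*-congˡ (×1-homo-* n j))))) ⟩
    ε * (fromℕ 10 * N + fromℕ 6 * (N * fromℕ j))
      ≈⟨ solve 5 (λ e a n b j → e :* (a :* n :+ b :* (n :* j)) := a :* (n :* e) :+ b :* (n :* (j :* e)))
           ≈-refl ε (fromℕ 10) N (fromℕ 6) (fromℕ j) ⟩
    fromℕ 10 * (N * ε) + fromℕ 6 * (N * (fromℕ j * ε))
      ≤⟨ +-mono-≤
           (*-monoˡ-≤ (0≤fromℕ 10) (*-monoˡ-≤ (0≤fromℕ n) (≤-trans (<⇒≤ ε<1) (1≤log₂ 2≤y))))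
           (*-monoˡ-≤ (0≤fromℕ 6) (*-monoˡ-≤ (0≤fromℕ n) (passes-bound m (τmax-nonNeg eq) 2≤y running))) ⟩
    fromℕ 10 * (N * L) + fromℕ 6 * (N * (fromℕ 4 * L))
      ≈⟨ solve 5 (λ a b c n l → a :* (n :* l) :+ b :* (n :* (c :* l)) := (a :+ b :* c) :* (n :* l))
           ≈-refl (fromℕ 10) (fromℕ 6) (fromℕ 4) N L ⟩
    (fromℕ 10 + fromℕ 6 * fromℕ 4) * (N * L)
      ≈⟨ *-congʳ (≈-trans (×-homo-+ 1# 10 24) (+-congˡ (×1-homo-* 6 4))) ⟨
    fromℕ 34 * (N * L)
      ≈⟨ *-congˡ (*-congʳ (x/y*y≈x N 0<ε)) ⟨
    fromℕ 34 * (N / ε * ε * L)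
      ≈⟨ solve 4 (λ k d e l → k :* (d :* e :* l) := e :* (k :* (d :* l))) ≈-refl (fromℕ 34) (N / ε) ε L ⟩
    ε * (fromℕ 34 * (N / ε * L)) ∎)
    where
    j = ℕ.pred m
    N = fromℕ n
    L = log₂ (R / ε)
    Q = queries (maxSingleton (allFin n)) ℕ.+ (queries c ℕ.+ 2)
    Q≤ : Q ℕ.≤ 10 ℕ.* n ℕ.+ 6 ℕ.* (n ℕ.* j)
    Q≤ = ℕ.≤-trans (ℕ.+-mono-≤
      (ℕ.≤-trans (maxSingleton-queries (allFin n))
        (ℕ.≤-reflexive (≡.cong (ℕ._* 2) (length-tabulate {n = n} id))))
      (ℕ.+-monoˡ-≤ 2 queries≤)) (query-count 1≤n m)

open import Defs using (Carrier; _≤_; _<_; _+_; _*_; _-_; _/_; 0#; 1#; fromℕ)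

theorem2 : ∃[ C ] ∀ ⦃ ℝ : Reals ⦄ {n : ℕ} (M : Matroid n) (r : ℕ) →
    Matroid.HasRank M r → 1 ℕ.≤ r →
    ∀ (f : SetFunction n) → NonMonotone f → NonNegative f → Submodular f →
    ∀ (ε : Carrier) → 0# < ε → ε < 1# →
    ∀ (choices : Choices n) →
    ∃ (TwinGreedyFast.Run M r f ε choices) ×
    (∀ {result} → TwinGreedyFast.Run M r f ε choices result →
    Matroid.Independent M (value result) ×
    (∀ (OPT : Carrier) → IsOptimum f M OPT →
    (1# / fromℕ 4 - ε) * OPT ≤ f (value result)) ×
    (fromℕ 2 ≤ fromℕ r / ε →
    fromℕ (queries result) ≤
    fromℕ C * (fromℕ n / ε * log₂ (fromℕ r / ε))))
theorem2 = 34 , λ ⦃ ℝ ⦄ M r rank 1≤r f _ 0≤f submodular ε 0<ε ε<1 choices →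
  let open Guarantees ⦃ ℝ ⦄ M r rank 1≤r f 0≤f submodular ε 0<ε ε<1 choices in
  run-exists , λ run → result-independent run , result-ratio run , result-queries run
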